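{- Suppose that single-machine 1-SORT is $\rho$-competitive and $\rho\le 2$. Then parallel 1-SORT is $\frac{2(m+\rho-1)}{m+1}$-competitive on $m$ identical machines.
   Context: Obligatory-test scheduling on $m\ge 1$ identical parallel machines: a set of jobs $J=\{1,\dots,N\}$ is available at time $0$. Each job $j$ has a test operation $\tau_j$ of known length $t_j\ge 0$ and a processing (execution) operation $\pi_j$ of initially unknown length $p_j\ge 0$, revealed only when $\tau_j$ completes. The operation $\pi_j$ cannot start before $\tau_j$ has completed; it may be executed on any machine and need not start immediately after $\tau_j$. Each machine executes at most one operation at a time, and operations are nonpreemptive. The completion time $C_j$ is the time at which $\pi_j$ finishes; the objective is to minimize $\sum_j C_j$. $\mathrm{OPT}(I)$ is the optimal offline objective value on instance $I$. A deterministic online algorithm is $\rho$-competitive if $\mathrm{ALG}(I)\le\rho\cdot\mathrm{OPT}(I)$ for every instance $I$, where OPT uses the same number of machines as the algorithm. Instances may be those with arbitrary test times or those with uniform test times ($t_j=1$ for all $j$); the hypothesis and the conclusion refer to the same class of instances. Running times: $\ell(\tau_j):=t_j$ and $\ell(\pi_j):=p_j$ (used only once $\tau_j$ has completed). Operations are compared by running time, with ties resolved by a fixed deterministic rule (the same rule for one and for $m$ machines). Parallel 1-SORT: all tests are available at time $0$; no execution operation is available initially. An event time is time $0$ or a time at which at least one operation completes. At each event time: (1) mark all operations completed at that time; (2) for every job $j$ whose test has just completed, reveal $p_j$ and make $\pi_j$ available; (3) let $r$ be the number of idle machines; (4) among all available unscheduled operations choose up to $r$ with smallest running times, ties broken deterministically;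 (5) start these on the idle machines. If fewer operations are available than idle machines, the remaining machines stay idle until the next event time. A zero-length operation completes at the time it is started, which triggers a further event at the same time. Single-machine 1-SORT is this rule with $m=1$, i.e. it always selects an available operation with minimum running time. -}

module Defs where

open import Level using (_⊔_) renaming (suc to lsuc)
open import Algebra.Core using (Op₁; Op₂)
open import Algebra.Structures using (IsCommutativeRing)
open import Algebra.Bundles using (CommutativeRing)
open import Data.Bool.Base using (Bool; true; false; if_then_else_)
open import Data.Fin.Base using (Fin)
open import Data.Fin.Properties using () renaming (_≟_ to _≟ᶠ_)
open import Data.List.Base
  using (List; []; _∷_; _++_; map; mapMaybe; filterᵇ; length; take; allFin)
open import Data.Maybe.Base using (Maybe; just; nothing)
open import Data.Nat.Base using (ℕ; zero; suc; _∸_) renaming (_*_ to _*ⁿ_)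
open import Data.Product.Base using (_×_; _,_; Σ-syntax)
open import Data.Product.Relation.Binary.Lex.NonStrict using (×-decTotalOrder)
open import Data.Sum.Base using (_⊎_)
open import Data.Unit.Polymorphic.Base using (⊤)
open import Function.Base using (_∘_)
open import Relation.Binary.Bundles using (DecTotalOrder; TotalOrder)
open import Relation.Binary.Core using (Rel)
open import Relation.Binary.Definitions using (DecidableEquality)
open import Relation.Binary.Structures using (IsDecTotalOrder)
open import Relation.Binary.PropositionalEquality.Core using (_≡_; _≢_; refl; cong)
open import Relation.Nullary.Decidable using (does; map′; no)
import Algebra.Definitions.RawMonoid as RawMonoid
import Data.List.Extrema as Extrema
import Data.List.Membership.DecPropositional as DecMembership
import Data.List.Sort.InsertionSort as InsertionSort
import Relation.Binary.Construct.On as On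

-- Running times and objective values live in an arbitrary (linearly) ordered
-- field; classically ℝ is an instance, and so is ℚ.
record OrderedField c ℓ : Set (lsuc (c ⊔ ℓ)) where
  infix  8 -_
  infix  9 _⁻¹
  infixl 7 _*_
  infixl 6 _+_
  infix  4 _≤_
  field
    Carrier           : Set c
    _≤_               : Rel Carrier ℓ
    _+_ _*_           : Op₂ Carrier
    -_ _⁻¹            : Op₁ Carrier
    0# 1#             : Carrier
    isCommutativeRing : IsCommutativeRing _≡_ _+_ _*_ -_ 0# 1#
    isDecTotalOrder   : IsDecTotalOrder _≡_ _≤_
    0≢1               : 0# ≢ 1#
    -- The value of 0# ⁻¹ is unconstrained.
    *-inverseʳ        : ∀ {x} → x ≢ 0# → x * x ⁻¹ ≡ 1#
    +-monoˡ-≤         : ∀ z {x y} → x ≤ y → x + z ≤ y + z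
    *-nonNeg          : ∀ {x y} → 0# ≤ x → 0# ≤ y → 0# ≤ x * y

  commutativeRing : CommutativeRing c c
  commutativeRing = record { isCommutativeRing = isCommutativeRing }

  decTotalOrder : DecTotalOrder c c ℓ
  decTotalOrder = record { isDecTotalOrder = isDecTotalOrder }

  totalOrder : TotalOrder c c ℓ
  totalOrder = DecTotalOrder.totalOrder decTotalOrder

  open IsDecTotalOrder isDecTotalOrder public using (_≤?_)
  open RawMonoid (CommutativeRing.+-rawMonoid commutativeRing) public
    using (sum) renaming (_×_ to _·_)

  infixl 6 _-_
  infixl 7 _/_

  _-_ : Op₂ Carrier
  x - y = x + (- y)

  _/_ : Op₂ Carrier
  x / y = x * y ⁻¹

  fromℕ : ℕ → Carrier
  fromℕ n = n · 1#

data Operation (N : ℕ) : Set where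
  τ π : Fin N → Operation N

infix 4 _≟_

_≟_ : ∀ {N} → DecidableEquality (Operation N)
τ i ≟ τ j = map′ (cong τ) (λ { refl → refl }) (i ≟ᶠ j)
τ i ≟ π j = no λ ()
π i ≟ τ j = no λ ()
π i ≟ π j = map′ (cong π) (λ { refl → refl }) (i ≟ᶠ j)

operations : ∀ N → List (Operation N)
operations N = map τ (allFin N) ++ map π (allFin N)

module Scheduling {c ℓ} (F : OrderedField c ℓ) where
  open OrderedField F

  record Instance : Set (c ⊔ ℓ) where
    field
      N   : ℕ
      t   : Fin N → Carrier
      p   : Fin N → Carrier
      0≤t : ∀ j → 0# ≤ t j
      0≤p : ∀ j → 0# ≤ p j

    runningTime : Operation N → Carrier
    runningTime (τ j) = t j
    runningTime (π j) = p j

  data TestTimes : Set where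
    arbitrary uniform : TestTimes

  InClass : TestTimes → Instance → Set c
  InClass arbitrary I = ⊤
  InClass uniform   I = ∀ j → Instance.t I j ≡ 1#

  module _ (I : Instance) where
    open Instance I

    record Schedule (m : ℕ) : Set (c ⊔ ℓ) where
      field
        machine : Operation N → Fin m
        start   : Operation N → Carrier

      end : Operation N → Carrier
      end o = start o + runningTime o

      field
        0≤start   : ∀ o → 0# ≤ start o
        testFirst : ∀ j → end (τ j) ≤ start (π j)
        noOverlap : ∀ o o′ → o ≢ o′ → machine o ≡ machine o′ →
                    end o ≤ start o′ ⊎ end o′ ≤ start o

      totalCompletionTime : Carrier
      totalCompletionTime = sum λ j → end (π j)

    record IsOPT (m : ℕ) (opt : Carrier) : Set (c ⊔ ℓ) where
      field
        attained : Σ[ S ∈ Schedule m ] Schedule.totalCompletionTime S ≡ opt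
        minimal  : (S : Schedule m) → opt ≤ Schedule.totalCompletionTime S

  Competitive : TestTimes → ℕ → (Instance → Carrier) → Carrier → Set (c ⊔ ℓ)
  Competitive class m alg ρ =
    ∀ I → InClass class I → ∀ opt → IsOPT I m opt → alg I ≤ ρ * opt

  -- A fixed rule for breaking ties between operations of equal running time.
  -- It may use the operations' identities and the known test times, and it
  -- does not depend on the number of machines.
  record TieRule r : Set (c ⊔ lsuc r) where
    field
      Before     : ∀ {N} → (Fin N → Carrier) → Rel (Operation N) r
      isTieOrder : ∀ {N} (t : Fin N → Carrier) →
                   IsDecTotalOrder _≡_ (Before t)

    tieOrder : ∀ {N} → (Fin N → Carrier) → DecTotalOrder _ _ r
    tieOrder t = record { isDecTotalOrder = isTieOrder t }

  module 1-SORT {r} (tie : TieRule r) (m : ℕ) (I : Instance) where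
    open Instance I

    -- Lexicographic: first the running time, then the tie rule.  The algorithm
    -- below only compares available operations, so that no p j is used
    -- before τ j has completed.
    priority : DecTotalOrder _ _ _
    priority = On.decTotalOrder
      (×-decTotalOrder decTotalOrder (TieRule.tieOrder tie t))
      (λ o → runningTime o , o)

    open InsertionSort priority using (sort)
    open DecMembership (_≟_ {N}) using (_∈?_)

    data Status : Set c where
      unavailable  : Status
      available    : Status
      runningUntil : Carrier → Status
      completedAt  : Carrier → Status

    State : Set c
    State = Operation N → Status

    initial : State
    initial (τ j) = available
    initial (π j) = unavailable

    isAvailable : Status → Bool
    isAvailable available = true
    isAvailable _         = false

    endOfRun : Status → Maybe Carrier
    endOfRun (runningUntil e) = just e
    endOfRun _                = nothing

    ends : State → List Carrier
    ends σ = mapMaybe (endOfRun ∘ σ) (operations N)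

    complete : Carrier → State → State
    complete now σ o with σ o
    ... | runningUntil e = if does (e ≤? now) then completedAt e else runningUntil e
    ... | s              = s

    reveal : State → State
    reveal σ (τ j) = σ (τ j)
    reveal σ (π j) with σ (π j) | σ (τ j)
    ... | unavailable | completedAt _ = available
    ... | s           | _             = s

    idle : State → ℕ
    idle σ = m ∸ length (ends σ)

    chosen : State → List (Operation N)
    chosen σ =
      take (idle σ) (sort (filterᵇ (isAvailable ∘ σ) (operations N)))

    startChosen : Carrier → State → State
    startChosen now σ o =
      if does (o ∈? chosen σ) then runningUntil (now + runningTime o) else σ o

    event : Carrier → State → State
    event now σ = startChosen now (reveal (complete now σ))

    nextEvent : State → Maybe Carrier
    nextEvent σ with ends σ
    ... | []     = nothing
    ... | e ∷ es = just (Extrema.min totalOrder e es)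

    -- The first argument bounds the number of events to be processed.
    run : ℕ → Carrier → State → State
    run zero    now σ = σ
    run (suc k) now σ with nextEvent (event now σ)
    ... | nothing   = event now σ
    ... | just now′ = run k now′ (event now σ)

    -- Every event after the one at time 0 completes at least one of the 2N
    -- operations, so 1 + 2N events suffice (for m ≥ 1).
    final : State
    final = run (suc (2 *ⁿ N)) 0# initial

    -- In the final state every operation is completed (for m ≥ 1), so the
    -- second clause is never used.
    completionTime : Fin N → Carrier
    completionTime j with final (π j)
    ... | completedAt e = e
    ... | _             = 0#

    totalCompletionTime : Carrier
    totalCompletionTime = sum completionTime

  1-SORT-cost : ∀ {r} → TieRule r → ℕ → Instance → Carrier
  1-SORT-cost tie m I = 1-SORT.totalCompletionTime tie m I

{-# OPTIONS --safe #-}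

-- For a job j let W j be the total running time of the operations that
-- single-machine 1-SORT executes up to and including π j, so that W j is a lower
-- bound for the completion time of j on one machine.  On m machines,
-- m (C j − q j) ≤ W j − q j for the length q j = t j + p j.  Indeed, while τ j
-- waits, all machines run operations counted by W j.  When τ j completes, either
-- π j starts at once, or all operations started so far are counted by W j and, while
-- π j waits, all machines again run such operations.  The dichotomy holds because once
-- an operation larger than π j is started, no smaller one is left waiting, and
-- afterwards every completed test frees a machine for the one operation it reveals.
--
-- Summing, m ALG ≤ ρ OPT₁ + (m − 1) Q with Q the total length.  The bound of Eastman,
-- Even and Isaacs, 2 m OPT ≥ 2 OPT₁ + (m − 1) Q, also holds if tests and executions
-- of a job use different machines: it follows from the mean busy times of the
-- jobs, the Cauchy–Schwarz inequality over the machines and the layers of the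
-- kernel min (q i) (q j).  With OPT₁ ≥ Q and ρ ≤ 2 the theorem is linear arithmetic.
module Submission where

open import Defs renaming (_≟_ to _≟ᵒ_)
open import Algebra.Bundles using (RawRing; module CommutativeRing)
open import Algebra.Solver.Ring.AlmostCommutativeRing
  using (AlmostCommutativeRing; fromCommutativeRing; _-Raw-AlmostCommutative⟶_)
open import Data.Bool.Base using (true; false; T; if_then_else_)
open import Data.Empty using (⊥)
open import Data.Fin.Base using (Fin; zero; suc)
open import Data.List.Base
  using (List; []; _∷_; _++_; map; mapMaybe; filter; filterᵇ; take; drop; tabulate; allFin; length)
open import Data.List.Membership.Propositional using (_∈_; _∉_; find; lose)
open import Data.List.Membership.Propositional.Properties
  using (∈-allFin; ∈-map⁺; ∈-map⁻; ∈-++⁺ˡ; ∈-++⁺ʳ; ∈-++⁻; ∈-filter⁺; ∈-filter⁻)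
open import Data.List.Properties
  using (length-filter; length-tabulate; take++drop≡id; length-take; length-map; length-++)
open import Data.List.Relation.Binary.Permutation.Propositional as Perm using (_↭_; ↭-sym; ↭⇒↭ₛ)
open import Data.List.Relation.Binary.Permutation.Propositional.Properties using (∈-resp-↭)
open import Data.List.Relation.Unary.All as All using (All; []; _∷_)
open import Data.List.Relation.Unary.AllPairs using (AllPairs; []; _∷_)
open import Data.List.Relation.Unary.Any using (here; there; any?)
open import Data.List.Relation.Unary.Sorted.TotalOrder.Properties using (Sorted⇒AllPairs)
open import Data.List.Relation.Unary.Unique.Propositional using (Unique)
open import Data.Maybe.Base using (Maybe; just; nothing)
open import Data.Nat.Base as ℕ using (ℕ; zero; suc; NonZero)
open import Data.Product.Base using (_×_; _,_; proj₁; proj₂; ∃-syntax)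
open import Data.Product.Relation.Binary.Lex.NonStrict using (×-decTotalOrder)
open import Data.Sum.Base using (_⊎_; inj₁; inj₂; [_,_]′)
open import Function.Base using (_∘_; id; case_of_)
open import Level using (Level; _⊔_)
open import Relation.Binary.Bundles using (DecTotalOrder)
open import Relation.Binary.Definitions using (DecidableEquality)
open import Relation.Binary.PropositionalEquality hiding ([_])
open import Relation.Nullary using (Dec; yes; no; does; ¬_; contradiction; ¬?; _×-dec_)
open import Relation.Nullary.Decidable using (T?; _⊎-dec_)
import Algebra.Construct.NaturalChoice.Min as Min
import Algebra.Construct.NaturalChoice.MinOp as MinOp
import Data.Fin.Properties as Fin
import Data.List.Extrema as Extrema
import Data.List.Relation.Binary.Permutation.Setoid.Properties as SetoidPermutation
import Data.List.Relation.Unary.All.Properties as All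
import Data.List.Relation.Unary.AllPairs.Properties as AllPairs
import Data.List.Relation.Unary.Unique.Propositional.Properties as Unique
import Data.List.Sort.InsertionSort.Base as InsertionSort
import Data.List.Sort.InsertionSort.Properties as InsertionSortProperties
import Data.Nat.Properties as ℕ
import Relation.Binary.Construct.On as On

-- `W` is defined from the priority order alone and does not mention the number of machines, so the
-- two runs never have to be compared event by event: each is bounded against the same quantity. The
-- hypothesis on `ρ` speaks only of instances whose optimum is exhibited. An optimal one-machine
-- schedule is therefore constructed, and its optimality is the case m = 1 of the
-- Eastman-Even-Isaacs bound. The term (m - 1) Q is the price of the fact that the two operations of
-- a job run one after the other. While `τ j` runs, only its own machine is known to do counted
-- work, and the other machines may start large operations; the difficulty is to show that these do
-- not delay `π j`. The ratio equals ρ at m = 1 and 2 at ρ = 2. The amount (m - 1)(2 - ρ)(OPT₁ - Q)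
-- lost in the final combination vanishes in both cases. Zero lengths are allowed, so several events
-- may share a time, and progress of the run is measured by unfinished operations instead of time.

module FieldProperties {c ℓ} (F : OrderedField c ℓ) where
  open OrderedField F hiding (commutativeRing; decTotalOrder; totalOrder)
  open OrderedField F public using () renaming (commutativeRing to ring)
  private module O = OrderedField F

  open CommutativeRing ring public
    using (+-comm; +-assoc; +-identityˡ; +-identityʳ; *-comm; *-assoc; *-identityˡ; *-identityʳ
          ; zeroˡ; zeroʳ; distribˡ; distribʳ; semiring; -‿inverseʳ; +-congˡ; *-congˡ; +-congʳ)
  open DecTotalOrder O.decTotalOrder public
    using () renaming (refl to ≤-refl; trans to ≤-trans; antisym to ≤-antisym; total to ≤-total
      ; reflexive to ≤-reflexive; _≟_ to _≟ᶜ_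
      ; ≤-respˡ-≈ to ≤-respˡ; ≤-respʳ-≈ to ≤-respʳ)

  -- A ring solver with integer coefficients.

  private
    ACR : AlmostCommutativeRing c c
    ACR = fromCommutativeRing ring

    open import Algebra.Properties.Semiring.Mult.TCOptimised semiring
      using (×-homo-+; ×1-homo-*) renaming (_×_ to _×′_)

    -- A pair (a , b) stands for the integer a − b; the solver needs unique representatives.
    reduce : ℕ → ℕ → ℕ × ℕ
    reduce a       zero    = a , 0
    reduce zero    (suc b) = 0 , suc b
    reduce (suc a) (suc b) = reduce a b

    differences : RawRing _ _
    differences = record
      { Carrier = ℕ × ℕ
      ; _≈_     = _≡_
      ; _+_     = λ { (a , b) (a′ , b′) → reduce (a ℕ.+ a′) (b ℕ.+ b′) }
      ; _*_     = λ { (a , b) (a′ , b′) → reduce (a ℕ.* a′ ℕ.+ b ℕ.* b′) (a ℕ.* b′ ℕ.+ b ℕ.* a′) }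
      ; -_      = λ { (a , b) → b , a }
      ; 0#      = 0 , 0
      ; 1#      = 1 , 0
      }

    -- Non-negative coefficients are kept in a form that computes to 0# and 1#.
    ⟦_⟧′ : ℕ × ℕ → Carrier
    ⟦ a , zero  ⟧′ = a ×′ 1#
    ⟦ a , suc b ⟧′ = a ×′ 1# - suc b ×′ 1#

    open import Algebra.Properties.Ring (CommutativeRing.ring ring)
      using (-0#≈0#; -‿distribˡ-*; -‿distribʳ-*; -‿involutive)
    open import Algebra.Properties.AbelianGroup (CommutativeRing.+-abelianGroup ring)
      using (⁻¹-∙-comm; ⁻¹-anti-homo-∙)
    open import Algebra.Properties.CommutativeSemigroup
      (CommutativeRing.+-commutativeSemigroup ring) using (interchange)

    ⟦⟧′-difference : ∀ a b → ⟦ a , b ⟧′ ≡ a ×′ 1# - b ×′ 1#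
    ⟦⟧′-difference a zero    = sym (trans (+-congˡ -0#≈0#) (+-identityʳ _))
    ⟦⟧′-difference a (suc b) = refl

    open ≡-Reasoning

    cancel : ∀ u v u′ v′ → u + v′ ≡ u′ + v → u - v ≡ u′ - v′
    cancel u v u′ v′ eq = begin
      u - v                    ≡⟨ +-identityʳ _ ⟨
      (u - v) + 0#             ≡⟨ +-congˡ (-‿inverseʳ v′) ⟨
      (u - v) + (v′ - v′)      ≡⟨ interchange _ _ _ _ ⟩
      (u + v′) + (- v - v′)    ≡⟨ cong₂ _+_ eq (+-comm _ _) ⟩
      (u′ + v) + (- v′ - v)    ≡⟨ interchange _ _ _ _ ⟩
      (u′ - v′) + (v - v)      ≡⟨ +-congˡ (-‿inverseʳ v) ⟩
      (u′ - v′) + 0#           ≡⟨ +-identityʳ _ ⟩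
      u′ - v′ ∎

    ⟦reduce⟧′ : ∀ a b → ⟦ reduce a b ⟧′ ≡ a ×′ 1# - b ×′ 1#
    ⟦reduce⟧′ a       zero    = ⟦⟧′-difference a zero
    ⟦reduce⟧′ zero    (suc b) = ⟦⟧′-difference zero (suc b)
    ⟦reduce⟧′ (suc a) (suc b) = trans (⟦reduce⟧′ a b) (cancel _ _ _ _
      (trans (+-congˡ (×-homo-+ 1# 1 b)) (trans (rotate _ _ _)
        (cong (_+ b ×′ 1#) (sym (×-homo-+ 1# 1 a))))))
      where
      rotate : ∀ x y z → x + (y + z) ≡ y + x + z
      rotate x y z = trans (sym (+-assoc x y z)) (cong (_+ z) (+-comm x y))

    +-homo : ∀ x y → ⟦ RawRing._+_ differences x y ⟧′ ≡ ⟦ x ⟧′ + ⟦ y ⟧′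
    +-homo (a , b) (a′ , b′) = begin
      ⟦ reduce (a ℕ.+ a′) (b ℕ.+ b′) ⟧′ ≡⟨ ⟦reduce⟧′ (a ℕ.+ a′) (b ℕ.+ b′) ⟩
      (a ℕ.+ a′) ×′ 1# - (b ℕ.+ b′) ×′ 1#
        ≡⟨ cong₂ _-_ (×-homo-+ 1# a a′) (×-homo-+ 1# b b′) ⟩
      (a ×′ 1# + a′ ×′ 1#) - (b ×′ 1# + b′ ×′ 1#)
        ≡⟨ +-congˡ (sym (⁻¹-∙-comm _ _)) ⟩
      (a ×′ 1# + a′ ×′ 1#) + (- (b ×′ 1#) + - (b′ ×′ 1#))
        ≡⟨ interchange _ _ _ _ ⟩
      (a ×′ 1# - b ×′ 1#) + (a′ ×′ 1# - b′ ×′ 1#)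
        ≡⟨ cong₂ _+_ (⟦⟧′-difference a b) (⟦⟧′-difference a′ b′) ⟨
      ⟦ a , b ⟧′ + ⟦ a′ , b′ ⟧′ ∎

    product-of-differences : ∀ u v u′ v′ →
      (u - v) * (u′ - v′) ≡ (u * u′ + v * v′) - (u * v′ + v * u′)
    product-of-differences u v u′ v′ = begin
      (u - v) * (u′ - v′) ≡⟨ distribʳ _ _ _ ⟩
      u * (u′ - v′) + - v * (u′ - v′) ≡⟨ cong₂ _+_ (distribˡ _ _ _) (distribˡ _ _ _) ⟩
      (u * u′ + u * - v′) + (- v * u′ + - v * - v′)
        ≡⟨ cong₂ _+_ (+-congˡ (sym (-‿distribʳ-* _ _)))
             (trans (+-comm _ _) (cong₂ _+_ (trans (sym (-‿distribˡ-* _ _))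
               (trans (cong -_ (sym (-‿distribʳ-* _ _))) (-‿involutive _)))
               (sym (-‿distribˡ-* _ _)))) ⟩
      (u * u′ + - (u * v′)) + (v * v′ + - (v * u′)) ≡⟨ interchange _ _ _ _ ⟩
      (u * u′ + v * v′) + (- (u * v′) + - (v * u′)) ≡⟨ +-congˡ (⁻¹-∙-comm _ _) ⟩
      (u * u′ + v * v′) - (u * v′ + v * u′) ∎

    *-homo : ∀ x y → ⟦ RawRing._*_ differences x y ⟧′ ≡ ⟦ x ⟧′ * ⟦ y ⟧′
    *-homo (a , b) (a′ , b′) = begin
      ⟦ reduce (a ℕ.* a′ ℕ.+ b ℕ.* b′) (a ℕ.* b′ ℕ.+ b ℕ.* a′) ⟧′
        ≡⟨ ⟦reduce⟧′ (a ℕ.* a′ ℕ.+ b ℕ.* b′) (a ℕ.* b′ ℕ.+ b ℕ.* a′) ⟩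
      (a ℕ.* a′ ℕ.+ b ℕ.* b′) ×′ 1# - (a ℕ.* b′ ℕ.+ b ℕ.* a′) ×′ 1#
        ≡⟨ cong₂ _-_ (homo a a′ b b′) (homo a b′ b a′) ⟩
      (a ×′ 1# * a′ ×′ 1# + b ×′ 1# * b′ ×′ 1#) - (a ×′ 1# * b′ ×′ 1# + b ×′ 1# * a′ ×′ 1#)
        ≡⟨ product-of-differences _ _ _ _ ⟨
      (a ×′ 1# - b ×′ 1#) * (a′ ×′ 1# - b′ ×′ 1#)
        ≡⟨ cong₂ _*_ (⟦⟧′-difference a b) (⟦⟧′-difference a′ b′) ⟨
      ⟦ a , b ⟧′ * ⟦ a′ , b′ ⟧′ ∎
      where
      homo : ∀ m n m′ n′ → (m ℕ.* n ℕ.+ m′ ℕ.* n′) ×′ 1# ≡ m ×′ 1# * n ×′ 1# + m′ ×′ 1# * n′ ×′ 1#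
      homo m n m′ n′ = trans (×-homo-+ 1# (m ℕ.* n) (m′ ℕ.* n′))
        (cong₂ _+_ (×1-homo-* m n) (×1-homo-* m′ n′))

    -‿homo : ∀ x → ⟦ RawRing.-_ differences x ⟧′ ≡ - ⟦ x ⟧′
    -‿homo (a , b) = begin
      ⟦ b , a ⟧′ ≡⟨ ⟦⟧′-difference b a ⟩
      b ×′ 1# - a ×′ 1# ≡⟨ +-comm _ _ ⟩
      - (a ×′ 1#) + b ×′ 1# ≡⟨ +-congˡ (sym (-‿involutive _)) ⟩
      - (a ×′ 1#) + - - (b ×′ 1#) ≡⟨ ⁻¹-∙-comm _ _ ⟩
      - (a ×′ 1# - b ×′ 1#) ≡⟨ cong -_ (⟦⟧′-difference a b) ⟨
      - ⟦ a , b ⟧′ ∎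

    morphism : differences -Raw-AlmostCommutative⟶ ACR
    morphism = record
      { ⟦_⟧    = ⟦_⟧′
      ; +-homo = +-homo
      ; *-homo = *-homo
      ; -‿homo = -‿homo
      ; 0-homo = refl
      ; 1-homo = refl
      }

    -- Equality is decided by cross sums of natural numbers, which compute; the field operations are
    -- abstract.
    coefficient≟ : ∀ x y → Maybe (⟦ x ⟧′ ≡ ⟦ y ⟧′)
    coefficient≟ (a , b) (a′ , b′) with a ℕ.+ b′ ℕ.≟ a′ ℕ.+ b
    ... | no  _  = nothing
    ... | yes eq = just (begin
      ⟦ a , b ⟧′ ≡⟨ ⟦⟧′-difference a b ⟩
      a ×′ 1# - b ×′ 1#
        ≡⟨ cancel _ _ _ _ (trans (sym (×-homo-+ 1# a b′))
             (trans (cong (_×′ 1#) eq) (×-homo-+ 1# a′ b))) ⟩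
      a′ ×′ 1# - b′ ×′ 1# ≡⟨ ⟦⟧′-difference a′ b′ ⟨
      ⟦ a′ , b′ ⟧′ ∎)

  open import Algebra.Solver.Ring differences ACR morphism coefficient≟ public
    using (Polynomial; solve; _:=_; _:+_; _:*_; _:-_; :-_; con)

  :0 :1 : ∀ {n} → Polynomial n
  :0 = con (0 , 0)
  :1 = con (1 , 0)

  -- Inequalities in an ordered field.

  0≤-difference : ∀ {x y} → x ≤ y → 0# ≤ y - x
  0≤-difference {x} {y} x≤y = subst (_≤ y - x) (-‿inverseʳ x) (+-monoˡ-≤ (- x) x≤y)

  -- Most inequalities below take this form: the solver checks that the gap between the two sides is
  -- the gap of a known inequality.
  difference-≤ : ∀ {x y a b} → b - a ≡ y - x → x ≤ y → a ≤ b
  difference-≤ {x} {y} {a} {b} eq x≤y = subst₂ _≤_ (+-identityˡ a)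
    (solve 2 (λ a b → (b :- a) :+ a := b) refl a b)
    (+-monoˡ-≤ a (subst (0# ≤_) (sym eq) (0≤-difference x≤y)))

  +-mono-≤ : ∀ {x y u v} → x ≤ y → u ≤ v → x + u ≤ y + v
  +-mono-≤ {x} {y} {u} {v} x≤y u≤v = ≤-trans (+-monoˡ-≤ u x≤y)
    (subst₂ _≤_ (+-comm u y) (+-comm v y) (+-monoˡ-≤ y u≤v))

  *-monoˡ-≤ : ∀ {z x y} → 0# ≤ z → x ≤ y → z * x ≤ z * y
  *-monoˡ-≤ {z} {x} {y} 0≤z x≤y = difference-≤
    (solve 3 (λ x y z → z :* y :- z :* x := z :* (y :- x) :- :0) refl x y z)
    (*-nonNeg 0≤z (0≤-difference x≤y))

  ≤-minus : ∀ {x y} → 0# ≤ y → x - y ≤ x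
  ≤-minus {x} {y} = difference-≤ (solve 2 (λ x y → x :- (x :- y) := y :- :0) refl x y)

  ≤-plus : ∀ {x y} → 0# ≤ y → x ≤ x + y
  ≤-plus {x} {y} = difference-≤ (solve 2 (λ x y → (x :+ y) :- x := y :- :0) refl x y)

  0≤+ : ∀ {x y} → 0# ≤ x → 0# ≤ y → 0# ≤ x + y
  0≤+ 0≤x 0≤y = ≤-trans 0≤x (≤-plus 0≤y)

  0≤square : ∀ x → 0# ≤ x * x
  0≤square x with ≤-total 0# x
  ... | inj₁ 0≤x = *-nonNeg 0≤x 0≤x
  ... | inj₂ x≤0 = difference-≤
    (solve 1 (λ x → x :* x :- :0 := (:0 :- x) :* (:0 :- x) :- :0) refl x)
    (*-nonNeg (0≤-difference x≤0) (0≤-difference x≤0))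

  0≤1 : 0# ≤ 1#
  0≤1 = subst (0# ≤_) (*-identityˡ 1#) (0≤square 1#)

  1≰0 : ¬ 1# ≤ 0#
  1≰0 1≤0 = 0≢1 (≤-antisym 0≤1 1≤0)

  fromℕ-+ : ∀ m n → fromℕ (m ℕ.+ n) ≡ fromℕ m + fromℕ n
  fromℕ-+ zero    n = sym (+-identityˡ _)
  fromℕ-+ (suc m) n = trans (cong (1# +_) (fromℕ-+ m n)) (sym (+-assoc _ _ _))

  0≤fromℕ : ∀ n → 0# ≤ fromℕ n
  0≤fromℕ zero    = ≤-refl
  0≤fromℕ (suc n) = 0≤+ 0≤1 (0≤fromℕ n)

  fromℕ-mono-≤ : ∀ {m n} → m ℕ.≤ n → fromℕ m ≤ fromℕ n
  fromℕ-mono-≤ {n = n} ℕ.z≤n = 0≤fromℕ n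
  fromℕ-mono-≤ (ℕ.s≤s m≤n)   = +-mono-≤ ≤-refl (fromℕ-mono-≤ m≤n)

  1+≰ : ∀ {x} → ¬ 1# + x ≤ x
  1+≰ {x} le = 1≰0 (difference-≤ (solve 1 (λ x → :0 :- :1 := x :- (:1 :+ x)) refl x) le)

  -- Machine counts are sums in the field; this brings them back to ℕ, where `idle` subtracts.
  fromℕ-cancel-≤ : ∀ {m n} → fromℕ m ≤ fromℕ n → m ℕ.≤ n
  fromℕ-cancel-≤ {m} {n} le with m ℕ.≤? n
  ... | yes m≤n = m≤n
  ... | no  m≰n = contradiction (≤-trans (fromℕ-mono-≤ (ℕ.≰⇒> m≰n)) le) 1+≰

  *-cancelˡ-≤ : ∀ {z x y} → 0# ≤ z → z ≢ 0# → z * x ≤ z * y → x ≤ y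
  *-cancelˡ-≤ {z} {x} {y} 0≤z z≢0 le = subst₂ _≤_ (undo x) (undo y) (*-monoˡ-≤ 0≤z⁻¹ le)
    where
    undo : ∀ x → z ⁻¹ * (z * x) ≡ x
    undo x = trans (solve 3 (λ x z i → i :* (z :* x) := (z :* i) :* x) refl x z (z ⁻¹))
      (trans (cong (_* x) (*-inverseʳ z≢0)) (*-identityˡ x))
    0≤z⁻¹ : 0# ≤ z ⁻¹
    0≤z⁻¹ with ≤-total 0# (z ⁻¹)
    ... | inj₁ 0≤z⁻¹ = 0≤z⁻¹
    ... | inj₂ z⁻¹≤0 = contradiction
      (subst₂ _≤_ (*-inverseʳ z≢0) (zeroʳ z) (*-monoˡ-≤ 0≤z z⁻¹≤0)) 1≰0

  0≤⁻¹ : ∀ {z} → 0# ≤ z → z ≢ 0# → 0# ≤ z ⁻¹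
  0≤⁻¹ {z} 0≤z z≢0 = *-cancelˡ-≤ 0≤z z≢0
    (subst₂ _≤_ (sym (zeroʳ z)) (sym (*-inverseʳ z≢0)) 0≤1)

  1+≢0 : ∀ {x} → 0# ≤ x → 1# + x ≢ 0#
  1+≢0 {x} 0≤x eq = 1+≰ (≤-trans (≤-reflexive eq) 0≤x)

  +-halve-≤ : ∀ {x y} → x + x ≤ y + y → x ≤ y
  +-halve-≤ {x} {y} le = *-cancelˡ-≤ (0≤+ 0≤1 0≤1) (1+≢0 0≤1) (subst₂ _≤_ (double x) (double y) le)
    where
    double : ∀ x → x + x ≡ (1# + 1#) * x
    double = solve 1 (λ x → x :+ x := (:1 :+ :1) :* x) refl

  -- Indicators and finite sums over lists.

  infix 3 _when_

  _when_ : ∀ {p} {P : Set p} → Carrier → Dec P → Carrier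
  x when P? = if does P? then x else 0#

  module _ {p} {P : Set p} where

    when-yes : ∀ {x} (P? : Dec P) → P → (x when P?) ≡ x
    when-yes (yes _)  _ = refl
    when-yes (no ¬p) p = contradiction p ¬p

    when-no : ∀ {x} (P? : Dec P) → ¬ P → (x when P?) ≡ 0#
    when-no (yes p) ¬p = contradiction p ¬p
    when-no (no _)  _  = refl

    0≤when : ∀ {x} (P? : Dec P) → 0# ≤ x → 0# ≤ (x when P?)
    0≤when (yes _) 0≤x = 0≤x
    0≤when (no _)  _   = ≤-refl

    when≤ : ∀ {x} (P? : Dec P) → 0# ≤ x → (x when P?) ≤ x
    when≤ (yes _) _   = ≤-refl
    when≤ (no _)  0≤x = 0≤x

  private variable
    a b : Level
    A : Set a
    B : Set b

  ∑ : List A → (A → Carrier) → Carrier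
  ∑ []       f = 0#
  ∑ (x ∷ xs) f = f x + ∑ xs f

  ∑-cong : ∀ (xs : List A) {f g} → (∀ x → f x ≡ g x) → ∑ xs f ≡ ∑ xs g
  ∑-cong []       f≡g = refl
  ∑-cong (x ∷ xs) f≡g = cong₂ _+_ (f≡g x) (∑-cong xs f≡g)

  ∑-mono : ∀ (xs : List A) {f g} → (∀ x → f x ≤ g x) → ∑ xs f ≤ ∑ xs g
  ∑-mono []       f≤g = ≤-refl
  ∑-mono (x ∷ xs) f≤g = +-mono-≤ (f≤g x) (∑-mono xs f≤g)

  ∑-zero : ∀ (xs : List A) → ∑ xs (λ _ → 0#) ≡ 0#
  ∑-zero []       = refl
  ∑-zero (x ∷ xs) = trans (+-identityˡ _) (∑-zero xs)

  ∑-nonNeg : ∀ (xs : List A) {f} → (∀ x → 0# ≤ f x) → 0# ≤ ∑ xs f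
  ∑-nonNeg xs {f} 0≤f = subst (_≤ ∑ xs f) (∑-zero xs) (∑-mono xs 0≤f)

  ∑-+ : ∀ (xs : List A) f g → ∑ xs (λ x → f x + g x) ≡ ∑ xs f + ∑ xs g
  ∑-+ []       f g = sym (+-identityˡ 0#)
  ∑-+ (x ∷ xs) f g = trans (cong (f x + g x +_) (∑-+ xs f g))
    (solve 4 (λ a b c d → a :+ b :+ (c :+ d) := a :+ c :+ (b :+ d)) refl
      (f x) (g x) (∑ xs f) (∑ xs g))

  ∑-*ˡ : ∀ (xs : List A) z f → ∑ xs (λ x → z * f x) ≡ z * ∑ xs f
  ∑-*ˡ []       z f = sym (zeroʳ z)
  ∑-*ˡ (x ∷ xs) z f = trans (cong (z * f x +_) (∑-*ˡ xs z f)) (sym (distribˡ _ _ _))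

  ∑-*ʳ : ∀ (xs : List A) z f → ∑ xs (λ x → f x * z) ≡ ∑ xs f * z
  ∑-*ʳ xs z f = trans (∑-cong xs λ x → *-comm (f x) z) (trans (∑-*ˡ xs z f) (*-comm z _))

  ∑-const : ∀ (xs : List A) z → ∑ xs (λ _ → z) ≡ fromℕ (length xs) * z
  ∑-const []       z = sym (zeroˡ z)
  ∑-const (x ∷ xs) z = trans (cong (z +_) (∑-const xs z))
    (solve 2 (λ z n → z :+ n :* z := (:1 :+ n) :* z) refl z (fromℕ (length xs)))

  ∑-++ : ∀ (xs : List A) ys f → ∑ (xs ++ ys) f ≡ ∑ xs f + ∑ ys f
  ∑-++ []       ys f = sym (+-identityˡ _)
  ∑-++ (x ∷ xs) ys f = trans (cong (f x +_) (∑-++ xs ys f)) (sym (+-assoc _ _ _))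

  ∑-map : ∀ (h : A → B) xs f → ∑ (map h xs) f ≡ ∑ xs (f ∘ h)
  ∑-map h []       f = refl
  ∑-map h (x ∷ xs) f = cong (f (h x) +_) (∑-map h xs f)

  ∑-swap : ∀ (xs : List A) (ys : List B) (f : A → B → Carrier) →
    ∑ xs (λ x → ∑ ys (f x)) ≡ ∑ ys (λ y → ∑ xs λ x → f x y)
  ∑-swap []       ys f = sym (∑-zero ys)
  ∑-swap (x ∷ xs) ys f = trans (cong (∑ ys (f x) +_) (∑-swap xs ys f))
    (sym (∑-+ ys (f x) λ y → ∑ xs λ x → f x y))

  ∑-filter : ∀ {p} {P : A → Set p} (P? : ∀ x → Dec (P x)) xs f →
    ∑ (filter P? xs) f ≡ ∑ xs λ x → f x when P? x
  ∑-filter P? []       f = refl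
  ∑-filter P? (x ∷ xs) f with does (P? x)
  ... | true  = cong (f x +_) (∑-filter P? xs f)
  ... | false = trans (∑-filter P? xs f) (sym (+-identityˡ _))

  ∑-↭ : ∀ {xs ys : List A} f → xs ↭ ys → ∑ xs f ≡ ∑ ys f
  ∑-↭ f Perm.refl          = refl
  ∑-↭ f (Perm.prep x p)    = cong (f x +_) (∑-↭ f p)
  ∑-↭ f (Perm.swap {xs} {ys} x y p) = trans (cong (λ s → f x + (f y + s)) (∑-↭ f p))
    (solve 3 (λ a b c → a :+ (b :+ c) := b :+ (a :+ c)) refl (f x) (f y) (∑ ys f))
  ∑-↭ f (Perm.trans p q)   = trans (∑-↭ f p) (∑-↭ f q)

  ∑-allFin : ∀ n (f : Fin n → Carrier) → ∑ (allFin n) f ≡ sum f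
  ∑-allFin n = go n id
    where
    go : ∀ n (g : Fin n → A) (f : A → Carrier) → ∑ (tabulate g) f ≡ sum (f ∘ g)
    go zero    g f = refl
    go (suc n) g f = cong (f (g zero) +_) (go n (g ∘ suc) f)

  module _ {A : Set a} (_≟_ : DecidableEquality A) where

    ∑-point-∉ : ∀ {x xs z} → x ∉ xs → ∑ xs (λ y → z when x ≟ y) ≡ 0#
    ∑-point-∉ {xs = []}      x∉ = refl
    ∑-point-∉ {x} {y ∷ xs} x∉ = trans (cong₂ _+_ (when-no (x ≟ y) (x∉ ∘ here))
      (∑-point-∉ (x∉ ∘ there))) (+-identityˡ 0#)

    ∑-point : ∀ {x xs} z → Unique xs → x ∈ xs → ∑ xs (λ y → z when x ≟ y) ≡ z
    ∑-point {x} {xs = y ∷ xs} z (y∉ ∷ u) (here refl) = trans (cong₂ _+_ (when-yes (x ≟ x) refl)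
      (∑-point-∉ λ y∈ → All.lookup y∉ y∈ refl)) (+-identityʳ z)
    ∑-point {x} {xs = y ∷ xs} z (y∉ ∷ u) (there x∈) = trans (cong₂ _+_
      (when-no (x ≟ y) λ { refl → All.lookup y∉ x∈ refl }) (∑-point z u x∈)) (+-identityˡ z)

-- Quadratic forms over lists, and packing of disjoint intervals.

module Inequalities {c ℓ} (F : OrderedField c ℓ) where
  open OrderedField F
  open FieldProperties F

  open Min totalOrder public using (_⊓_; x≤y⇒x⊓y≈x)
  open MinOp (Min.minOperator totalOrder) public using (x⊓y≤x; x⊓y≤y; ⊓-comm; ⊓-glb)

  private variable
    a : Level
    A : Set a

  ∑∑ : List A → (A → A → Carrier) → Carrier
  ∑∑ xs g = ∑ xs λ x → ∑ xs (g x)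

  ∑∑-cong : ∀ (xs : List A) {g h} → (∀ x y → g x y ≡ h x y) → ∑∑ xs g ≡ ∑∑ xs h
  ∑∑-cong xs eq = ∑-cong xs λ x → ∑-cong xs (eq x)

  ∑∑-mono : ∀ (xs : List A) {g h} → (∀ x y → g x y ≤ h x y) → ∑∑ xs g ≤ ∑∑ xs h
  ∑∑-mono xs le = ∑-mono xs λ x → ∑-mono xs (le x)

  ∑∑-+ : ∀ (xs : List A) g h → ∑∑ xs (λ x y → g x y + h x y) ≡ ∑∑ xs g + ∑∑ xs h
  ∑∑-+ xs g h = trans (∑-cong xs λ x → ∑-+ xs (g x) (h x)) (∑-+ xs _ _)

  ∑∑-*ˡ : ∀ (xs : List A) z g → ∑∑ xs (λ x y → z * g x y) ≡ z * ∑∑ xs g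
  ∑∑-*ˡ xs z g = trans (∑-cong xs λ x → ∑-*ˡ xs z (g x)) (∑-*ˡ xs z _)

  ∑∑-↭ : ∀ {xs ys : List A} g → xs ↭ ys → ∑∑ xs g ≡ ∑∑ ys g
  ∑∑-↭ {xs = xs} g p = trans (∑-cong xs λ x → ∑-↭ (g x) p) (∑-↭ _ p)

  ∑∑-product : ∀ (xs : List A) f g → ∑∑ xs (λ x y → f x * g y) ≡ ∑ xs f * ∑ xs g
  ∑∑-product xs f g = trans (∑-cong xs λ x → ∑-*ˡ xs (f x) g) (∑-*ʳ xs (∑ xs g) f)

  ∑-zero-All : ∀ {xs : List A} {f} → All (λ x → f x ≡ 0#) xs → ∑ xs f ≡ 0#
  ∑-zero-All []           = refl
  ∑-zero-All (eq ∷ eqs) = trans (cong₂ _+_ eq (∑-zero-All eqs)) (+-identityʳ 0#)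

  ∑∑-∷-zero : ∀ x (xs : List A) g → g x x ≡ 0# → All (λ y → g x y ≡ 0#) xs →
    All (λ y → g y x ≡ 0#) xs → ∑∑ (x ∷ xs) g ≡ ∑∑ xs g
  ∑∑-∷-zero x xs g diagonal row column = trans
    (cong₂ _+_ (trans (cong₂ _+_ diagonal (∑-zero-All row)) (+-identityʳ 0#))
      (trans (∑-+ xs _ _) (trans (cong (_+ ∑∑ xs g) (∑-zero-All column)) (+-identityˡ _))))
    (+-identityˡ _)

  module _ {A : Set a} (q : A → Carrier) (0≤q : ∀ x → 0# ≤ q x) (g : A → A → Carrier)
           (∑∑g-nonNeg : ∀ xs → 0# ≤ ∑∑ xs g) where

    private
      byValue : DecTotalOrder _ _ _
      byValue = On.decTotalOrder decTotalOrder q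

      -- The layer of all x with q x above the least value of q contributes
      -- a nonnegative multiple of ∑∑ g, and above that layer the least element
      -- no longer matters.
      sorted-layers : ∀ {xs} → AllPairs (λ x y → q x ≤ q y) xs →
        ∀ y → All (λ x → y ≤ q x) xs → 0# ≤ ∑∑ xs λ u v → g u v * (q u ⊓ q v - y)
      sorted-layers []              y []           = ≤-refl
      sorted-layers {x ∷ xs} (x≤ ∷ ps) y (y≤x ∷ _) = subst (0# ≤_) (sym split)
        (0≤+ (*-nonNeg (0≤-difference y≤x) (∑∑g-nonNeg (x ∷ xs))) (sorted-layers ps (q x) x≤))
        where
        above : A → A → Carrier
        above u v = g u v * (q u ⊓ q v - q x)
        vanish : ∀ {u v} → q u ⊓ q v ≡ q x → above u v ≡ 0#
        vanish {u} {v} eq = trans (cong (λ z → g u v * (z - q x)) eq)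
          (solve 2 (λ g q → g :* (q :- q) := :0) refl (g u v) (q x))
        split : ∑∑ (x ∷ xs) (λ u v → g u v * (q u ⊓ q v - y))
              ≡ (q x - y) * ∑∑ (x ∷ xs) g + ∑∑ xs above
        split = trans
          (∑∑-cong (x ∷ xs) λ u v → solve 4 (λ g k a y → g :* (k :- y) := (a :- y) :* g :+ g :* (k :- a))
            refl (g u v) (q u ⊓ q v) (q x) y)
          (trans (∑∑-+ (x ∷ xs) _ above) (cong₂ _+_ (∑∑-*ˡ (x ∷ xs) (q x - y) g)
            (∑∑-∷-zero x xs above (vanish (x≤y⇒x⊓y≈x ≤-refl))
              (All.map (λ x≤v → vanish (x≤y⇒x⊓y≈x x≤v)) x≤)
              (All.map (λ x≤u → vanish (trans (⊓-comm _ _) (x≤y⇒x⊓y≈x x≤u))) x≤))))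

    -- The minimum kernel is a nonnegative combination of the indicators of layers, each layer being
    -- a suffix of the sorted list. This is why `g` must have nonnegative sums on every list and not
    -- only on `xs`.
    ∑∑-⊓-nonNeg : ∀ xs → 0# ≤ ∑∑ xs λ x y → g x y * (q x ⊓ q y)
    ∑∑-⊓-nonNeg xs = subst (0# ≤_) eq
      (sorted-layers (Sorted⇒AllPairs (DecTotalOrder.totalOrder byValue) (InsertionSortProperties.sort-↗ byValue xs))
        0# (All.universal 0≤q _))
      where
      eq : ∑∑ (InsertionSort.sort byValue xs) (λ u v → g u v * (q u ⊓ q v - 0#))
         ≡ ∑∑ xs λ x y → g x y * (q x ⊓ q y)
      eq = trans (∑∑-↭ _ (InsertionSortProperties.sort-↭ byValue xs)) (∑∑-cong xs λ x y →
        solve 2 (λ g k → g :* (k :- :0) := g :* k) refl (g x y) (q x ⊓ q y))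

  -- Cauchy-Schwarz against the constant 1: the squares of `f x - f y` are added over all ordered
  -- pairs, where both sides appear twice.
  square-∑≤ : ∀ (xs : List A) f → ∑ xs f * ∑ xs f ≤ fromℕ (length xs) * ∑ xs λ x → f x * f x
  square-∑≤ xs f = +-halve-≤ (subst₂ _≤_
    (trans (∑∑-+ xs _ _) (cong₂ _+_ (∑∑-product xs f f) (∑∑-product xs f f)))
    (trans (∑∑-+ xs _ _) (cong₂ _+_
      (trans (∑-cong xs λ x → ∑-const xs (f x * f x)) (∑-*ˡ xs _ _))
      (∑-const xs (∑ xs λ y → f y * f y))))
    (∑∑-mono xs λ x y → difference-≤
      (solve 2 (λ x y → (x :* x :+ y :* y) :- (x :* y :+ x :* y) := (x :- y) :* (x :- y) :- :0)
        refl (f x) (f y))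
      (0≤square (f x - f y))))

  module _ {A : Set a} {m} (machine : A → Fin m) (f : A → Carrier) where

    private
      load : List A → Fin m → Carrier
      load xs h = ∑ xs λ x → f x * (1# when machine x Fin.≟ h)

      shared : A → A → Carrier
      shared x y = 1# when machine x Fin.≟ machine y

      ∑-load : ∀ xs → ∑ (allFin m) (load xs) ≡ ∑ xs f
      ∑-load xs = trans (∑-swap (allFin m) xs λ h x → f x * (1# when machine x Fin.≟ h))
        (∑-cong xs λ x → trans (∑-*ˡ (allFin m) (f x) _)
          (trans (cong (f x *_) (∑-point Fin._≟_ 1# (Unique.allFin⁺ m) (∈-allFin (machine x))))
            (*-identityʳ (f x))))

      ∑-shared : ∀ (i j : Fin m) →
        ∑ (allFin m) (λ h → (1# when i Fin.≟ h) * (1# when j Fin.≟ h)) ≡ (1# when i Fin.≟ j)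
      ∑-shared i j = trans (∑-cong (allFin m) pointwise)
        (∑-point Fin._≟_ (1# when i Fin.≟ j) (Unique.allFin⁺ m) (∈-allFin j))
        where
        pointwise : ∀ h → (1# when i Fin.≟ h) * (1# when j Fin.≟ h) ≡ ((1# when i Fin.≟ j) when j Fin.≟ h)
        pointwise h with j Fin.≟ h
        ... | yes refl = *-identityʳ _
        ... | no  _    = zeroʳ _

      ∑-load² : ∀ xs → ∑ (allFin m) (λ h → load xs h * load xs h)
                     ≡ ∑∑ xs λ x y → f x * f y * shared x y
      ∑-load² xs = trans
        (∑-cong (allFin m) λ h → sym (∑∑-product xs _ _))
        (trans (∑-swap (allFin m) xs _) (∑-cong xs λ x →
          trans (∑-swap (allFin m) xs _) (∑-cong xs λ y →
            trans (∑-cong (allFin m) λ h → solve 4 (λ a b c d → a :* b :* (c :* d) := a :* c :* (b :* d))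
              refl (f x) _ (f y) _)
            (trans (∑-*ˡ (allFin m) (f x * f y) _)
              (cong (f x * f y *_) (∑-shared (machine x) (machine y)))))))

    -- The double sum is m times the sum of the squared machine loads minus the square of the total
    -- load. It is nonnegative for every list, as the layer argument demands.
    ∑∑-shared-nonNeg : ∀ xs → 0# ≤ ∑∑ xs λ x y →
      f x * f y * (fromℕ m * (1# when machine x Fin.≟ machine y) - 1#)
    ∑∑-shared-nonNeg xs = difference-≤
      (trans (cong (_- 0#) split) (solve 2 (λ u v → (u :- v) :- :0 := u :- v) refl _ _))
      (square-∑≤ (allFin m) (load xs))
      where
      split : ∑∑ xs (λ x y → f x * f y * (fromℕ m * shared x y - 1#))
        ≡ fromℕ (length (allFin m)) * ∑ (allFin m) (λ h → load xs h * load xs h)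
        - ∑ (allFin m) (load xs) * ∑ (allFin m) (load xs)
      split rewrite length-tabulate {n = m} id | ∑-load xs | ∑-load² xs = trans
        (∑∑-cong xs λ x y → solve 4 (λ a b m s → a :* b :* (m :* s :- :1) := m :* (a :* b :* s) :+ (:- :1) :* (a :* b))
          refl (f x) (f y) (fromℕ m) (shared x y))
        (trans (∑∑-+ xs _ _) (trans (cong₂ _+_ (∑∑-*ˡ xs (fromℕ m) _)
          (trans (∑∑-*ˡ xs (- 1#) _) (cong (- 1# *_) (∑∑-product xs f f))))
          (solve 2 (λ u v → u :+ (:- :1) :* v := u :- v) refl _ _)))

  module _ {A : Set a} (s e : A → Carrier) where

    Disjoint : A → A → Set _
    Disjoint x y = e x ≤ s y ⊎ e y ≤ s x

    -- The first interval splits the others into those before and those after it.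
    packing : ∀ n xs → length xs ℕ.≤ n → AllPairs Disjoint xs → ∀ {u v} → u ≤ v →
      All (λ x → u ≤ s x) xs → All (λ x → e x ≤ v) xs → ∑ xs (λ x → e x - s x) ≤ v - u
    packing n       []       _              _        u≤v _         _         = 0≤-difference u≤v
    -- The recursion is on the bound `n`, because the filtered lists are not sublists by structure.
    packing (suc n) (x ∷ xs) (ℕ.s≤s |xs|≤n) (dx ∷ ds) {u} {v} _ (u≤x ∷ us) (x≤v ∷ vs) =
      subst (_≤ v - u) (cong (e x - s x +_) split) (difference-≤
        (solve 6 (λ u v s e l r → (v :- u) :- (e :- s :+ (l :+ r)) := ((s :- u) :+ (v :- e)) :- (l :+ r))
          refl u v (s x) (e x) _ _)
        (+-mono-≤ before after))
      where
      before? : ∀ y → Dec (e y ≤ s x)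
      before? y = e y ≤? s x
      after? : ∀ y → Dec (¬ e y ≤ s x)
      after? y = ¬? (before? y)
      before : ∑ (filter before? xs) (λ y → e y - s y) ≤ s x - u
      before = packing n (filter before? xs) (ℕ.≤-trans (length-filter before? xs) |xs|≤n)
        (AllPairs.filter⁺ before? ds) u≤x (All.filter⁺ before? us) (All.all-filter before? xs)
      after : ∑ (filter after? xs) (λ y → e y - s y) ≤ v - e x
      after = packing n (filter after? xs) (ℕ.≤-trans (length-filter after? xs) |xs|≤n)
        (AllPairs.filter⁺ after? ds) x≤v
        -- By disjointness, an interval that does not end before `x` starts can only begin once `x`
        -- has ended.
        (All.zipWith (λ { (y≰x , d) → [ id , (λ y≤x → contradiction y≤x y≰x) ]′ d })
          (All.all-filter after? xs , All.filter⁺ after? dx))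
        (All.filter⁺ after? vs)
      split : ∑ (filter before? xs) (λ y → e y - s y) + ∑ (filter after? xs) (λ y → e y - s y)
            ≡ ∑ xs λ y → e y - s y
      split = trans (cong₂ _+_ (∑-filter before? xs _) (∑-filter after? xs _))
        (trans (sym (∑-+ xs _ _)) (∑-cong xs pointwise))
        where
        pointwise : ∀ y → ((e y - s y) when before? y) + ((e y - s y) when after? y) ≡ e y - s y
        pointwise y with e y ≤? s x
        ... | yes _ = +-identityʳ _
        ... | no  _ = +-identityˡ _

operations-unique : ∀ N → Unique (operations N)
operations-unique N = Unique.++⁺
  (Unique.map⁺ (λ { refl → refl }) (Unique.allFin⁺ N))
  (Unique.map⁺ (λ { refl → refl }) (Unique.allFin⁺ N))
  λ { (∈τ , ∈π) → case-τπ (∈-map⁻ τ ∈τ) (∈-map⁻ π ∈π) }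
  where
  case-τπ : ∀ {o} → (∃[ i ] i ∈ allFin N × o ≡ τ i) → (∃[ i ] i ∈ allFin N × o ≡ π i) → ⊥
  case-τπ (_ , _ , refl) (_ , _ , ())

∈-operations : ∀ {N} (o : Operation N) → o ∈ operations N
∈-operations         (τ i) = ∈-++⁺ˡ (∈-map⁺ τ (∈-allFin i))
∈-operations {N} (π i) = ∈-++⁺ʳ (map τ (allFin N)) (∈-map⁺ π (∈-allFin i))

job : ∀ {N} → Operation N → Fin N
job (τ i) = i
job (π i) = i

-- Offline schedules: the lower bound on m machines.

module Offline {c ℓ} (F : OrderedField c ℓ) (I : Scheduling.Instance F) where
  open OrderedField F
  open FieldProperties F
  open Inequalities F
  open Scheduling F
  open Instance I

  jobs : List (Fin N)
  jobs = allFin N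

  ops : List (Operation N)
  ops = operations N

  ∑-ops : ∀ f → ∑ ops f ≡ ∑ jobs λ j → f (τ j) + f (π j)
  ∑-ops f = trans (∑-++ (map τ jobs) (map π jobs) f)
    (trans (cong₂ _+_ (∑-map τ jobs f) (∑-map π jobs f)) (sym (∑-+ jobs _ _)))

  ∑-ops-point : ∀ o z → ∑ ops (λ o′ → z when o ≟ᵒ o′) ≡ z
  ∑-ops-point o z = ∑-point _≟ᵒ_ z (operations-unique N) (∈-operations o)

  ∑-jobs-point : ∀ j z → ∑ jobs (λ j′ → z when j Fin.≟ j′) ≡ z
  ∑-jobs-point j z = ∑-point Fin._≟_ z (Unique.allFin⁺ N) (∈-allFin j)

  q : Fin N → Carrier
  q j = t j + p j

  Q : Carrier
  Q = ∑ jobs q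

  0≤runningTime : ∀ o → 0# ≤ runningTime o
  0≤runningTime (τ j) = 0≤t j
  0≤runningTime (π j) = 0≤p j

  runningTime≤q : ∀ o → runningTime o ≤ q (job o)
  runningTime≤q (τ j) = ≤-plus (0≤p j)
  runningTime≤q (π j) = subst (p j ≤_) (+-comm (p j) (t j)) (≤-plus (0≤t j))

  0≤q : ∀ j → 0# ≤ q j
  0≤q j = 0≤+ (0≤t j) (0≤p j)

  0≤⊓ : ∀ i j → 0# ≤ q i ⊓ q j
  0≤⊓ i j = ⊓-glb (0≤q i) (0≤q j)

  module _ {m} (S : Schedule I m) where
    open Schedule S

    private
      -- The value 0 at zero-length jobs replaces the unconstrained `0# ⁻¹`, so that such jobs get
      -- weight 0.
      q⁻¹ : Fin N → Carrier
      q⁻¹ j = q j ⁻¹ when ¬? (q j ≟ᶜ 0#)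

      0≤q⁻¹ : ∀ j → 0# ≤ q⁻¹ j
      0≤q⁻¹ j with q j ≟ᶜ 0#
      ... | yes _  = ≤-refl
      ... | no q≢0 = 0≤⁻¹ (0≤q j) q≢0

      q*q⁻¹≤1 : ∀ j → q j * q⁻¹ j ≤ 1#
      q*q⁻¹≤1 j with q j ≟ᶜ 0#
      ... | yes _  = subst (_≤ 1#) (sym (zeroʳ (q j))) 0≤1
      ... | no q≢0 = ≤-reflexive (*-inverseʳ q≢0)

      -- The share of an operation in the length of its job. With these shares as weights, the
      -- midpoints of the two operations average to the mean busy time of the job.
      fraction : Operation N → Carrier
      fraction o = runningTime o * q⁻¹ (job o)

      0≤fraction : ∀ o → 0# ≤ fraction o
      0≤fraction o = *-nonNeg (0≤runningTime o) (0≤q⁻¹ (job o))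

      fraction*q : ∀ o → fraction o * q (job o) ≡ runningTime o
      fraction*q o with q (job o) ≟ᶜ 0#
      ... | yes q≡0 = trans (*-congˡ q≡0) (trans (zeroʳ _)
        (≤-antisym (0≤runningTime o) (subst (runningTime o ≤_) q≡0 (runningTime≤q o))))
      ... | no q≢0 = trans (solve 3 (λ r i q → r :* i :* q := r :* (q :* i)) refl _ _ _)
        (trans (cong (runningTime o *_) (*-inverseʳ q≢0)) (*-identityʳ _))

      kernel : Operation N → Operation N → Carrier
      kernel o o′ = q (job o) ⊓ q (job o′)

      -- Twice the midpoint of the run of the operation; the doubling avoids halves.
      doubledMidpoint : Operation N → Carrier
      doubledMidpoint o = start o + start o + runningTime o

      -- The mean busy time of a job precedes its completion by at least half its length.
      job-midpoint : ∀ j → fraction (τ j) * doubledMidpoint (τ j) + fraction (π j) * doubledMidpoint (π j)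
        ≤ end (π j) + end (π j) - q j
      job-midpoint j = ≤-trans
        -- Moving `τ j` directly in front of `π j` only raises the sum, which then is `q j * q⁻¹ j`
        -- times the right side. That factor is 0 for a zero-length job, so the right side has to be
        -- known nonnegative.
        (+-mono-≤ (*-monoˡ-≤ (0≤fraction (τ j)) τ-bound) ≤-refl)
        (subst₂ _≤_
          (solve 4 (λ t p i s → (s :+ s :+ p :- t) :* ((t :+ p) :* i) := t :* i :* (s :+ s :- t) :+ p :* i :* (s :+ s :+ p))
            refl (t j) (p j) (q⁻¹ j) (start (π j)))
          (solve 3 (λ t p s → (s :+ s :+ p :- t) :* :1 := (s :+ p) :+ (s :+ p) :- (t :+ p))
            refl (t j) (p j) (start (π j)))
          (*-monoˡ-≤ 0≤end (q*q⁻¹≤1 j)))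
        where
        τ-bound : doubledMidpoint (τ j) ≤ start (π j) + start (π j) - t j
        τ-bound = difference-≤ (solve 3 (λ s s′ t → (s′ :+ s′ :- t) :- (s :+ s :+ t) := (s′ :+ s′) :- (s :+ t :+ (s :+ t)))
          refl (start (τ j)) (start (π j)) (t j)) (+-mono-≤ (testFirst j) (testFirst j))
        0≤end : 0# ≤ start (π j) + start (π j) + p j - t j
        0≤end = difference-≤ (solve 4 (λ s s′ t p → (s′ :+ s′ :+ p :- t) :- :0 := (s′ :+ s′ :+ s :+ p) :- (s :+ t))
          refl (start (τ j)) (start (π j)) (t j) (p j))
          (≤-trans (testFirst j) (difference-≤ (solve 3 (λ s s′ p → (s′ :+ s′ :+ s :+ p) :- s′ := (s′ :+ s :+ p) :- :0)
            refl (start (τ j)) (start (π j)) (p j)) (0≤+ (0≤+ (0≤start (π j)) (0≤start (τ j))) (0≤p j))))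

      Precedes : Operation N → Operation N → Set _
      Precedes o o′ = o ≢ o′ × machine o ≡ machine o′ × end o ≤ start o′

      precedes? : ∀ o o′ → Dec (Precedes o o′)
      precedes? o o′ = ¬? (o ≟ᵒ o′) ×-dec machine o Fin.≟ machine o′ ×-dec end o ≤? start o′

      -- These operations occupy disjoint intervals between time 0 and `start o′`, so `packing`
      -- applies.
      ∑-preceding : ∀ o′ → ∑ ops (λ o → runningTime o when precedes? o o′) ≤ start o′
      ∑-preceding o′ = subst₂ _≤_
        (trans (∑-cong preceding λ o → solve 2 (λ s r → s :+ r :- s := r)
            refl (start o) (runningTime o))
          (∑-filter (λ o → precedes? o o′) ops runningTime))
        (solve 1 (λ s → s :- :0 := s) refl (start o′))
        (packing start end (length preceding) preceding ℕ.≤-refl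
          (disjoint (Unique.filter⁺ (λ o → precedes? o o′) (operations-unique N)) precede) (0≤start o′)
          (All.universal 0≤start preceding)
          (All.map (proj₂ ∘ proj₂) precede))
        where
        preceding : List (Operation N)
        preceding = filter (λ o → precedes? o o′) ops
        precede : All (λ o → Precedes o o′) preceding
        precede = All.all-filter (λ o → precedes? o o′) ops
        disjoint : ∀ {xs} → Unique xs → All (λ o → Precedes o o′) xs → AllPairs (Disjoint start end) xs
        disjoint []       []                     = []
        disjoint (x∉ ∷ u) ((_ , x~o′ , _) ∷ prs) = All.zipWith
          (λ { (x≢y , _ , y~o′ , _) → noOverlap _ _ x≢y (trans x~o′ (sym y~o′)) }) (x∉ , prs)
          ∷ disjoint u prs

      shared-kernel : Operation N → Operation N → Carrier
      shared-kernel o o′ = fraction o * fraction o′ * (1# when machine o Fin.≟ machine o′) * kernel o o′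

      wait own : Operation N → Operation N → Carrier
      wait o o′ = fraction o * (runningTime o′ when precedes? o′ o)
      own o o′ = fraction o * runningTime o when o ≟ᵒ o′

      0≤wait : ∀ o o′ → 0# ≤ wait o o′
      0≤wait o o′ = *-nonNeg (0≤fraction o) (0≤when (precedes? o′ o) (0≤runningTime o′))

      0≤own : ∀ o o′ → 0# ≤ own o o′
      0≤own o o′ = 0≤when (o ≟ᵒ o′) (*-nonNeg (0≤fraction o) (0≤runningTime o))

      fraction-kernel≤ : ∀ o o′ → fraction o * fraction o′ * 1# * kernel o o′ ≤ fraction o * runningTime o′
      fraction-kernel≤ o o′ = subst₂ _≤_
        (solve 3 (λ f g k → f :* (g :* k) := f :* g :* :1 :* k)
            refl (fraction o) (fraction o′) (kernel o o′))
        (cong (fraction o *_) (fraction*q o′))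
        (*-monoˡ-≤ (0≤fraction o) (*-monoˡ-≤ (0≤fraction o′) (x⊓y≤y _ _)))

      wait-precedes : ∀ o o′ → Precedes o′ o → fraction o * fraction o′ * 1# * kernel o o′ ≤ wait o o′
      wait-precedes o o′ pr = subst (λ z → fraction o * fraction o′ * 1# * kernel o o′ ≤ fraction o * z)
        (sym (when-yes (precedes? o′ o) pr)) (fraction-kernel≤ o o′)

      -- Of two operations on one machine, the later one is charged the length of the earlier one:
      -- bounding the minimum by the job length of the earlier operation turns its fraction into its
      -- running time. The diagonal is paid by `own`.
      shared-kernel≤ : ∀ o o′ → shared-kernel o o′ ≤ wait o o′ + wait o′ o + own o o′
      shared-kernel≤ o o′ = by-cases (o ≟ᵒ o′) (machine o Fin.≟ machine o′)
        where
        f k : Carrier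
        f = fraction o * fraction o′
        k = kernel o o′

        0≤waits : 0# ≤ wait o o′ + wait o′ o
        0≤waits = 0≤+ (0≤wait o o′) (0≤wait o′ o)

        shared : machine o ≡ machine o′ → ∀ {z} → f * 1# * k ≤ z → shared-kernel o o′ ≤ z
        shared o~o′ = subst (λ z → f * z * k ≤ _) (sym (when-yes (machine o Fin.≟ machine o′) o~o′))

        ordered : end o ≤ start o′ ⊎ end o′ ≤ start o → o ≢ o′ → machine o ≡ machine o′ →
          f * 1# * k ≤ wait o o′ + wait o′ o
        ordered (inj₁ o≤o′) o≢o′ o~o′ = ≤-trans
          (subst (_≤ wait o′ o) (cong₂ _*_ (cong (_* 1#) (*-comm _ _)) (⊓-comm _ _))
            (wait-precedes o′ o (o≢o′ , o~o′ , o≤o′)))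
          (difference-≤ (solve 2 (λ u v → (u :+ v) :- v := u :- :0)
              refl (wait o o′) (wait o′ o)) (0≤wait o o′))
        ordered (inj₂ o′≤o) o≢o′ o~o′ = ≤-trans
          (wait-precedes o o′ (o≢o′ ∘ sym , sym o~o′ , o′≤o)) (≤-plus (0≤wait o′ o))

        by-cases : Dec (o ≡ o′) → Dec (machine o ≡ machine o′) →
          shared-kernel o o′ ≤ wait o o′ + wait o′ o + own o o′
        by-cases (no o≢o′)  (yes o~o′) = ≤-trans
          (shared o~o′ (ordered (noOverlap o o′ o≢o′ o~o′) o≢o′ o~o′)) (≤-plus (0≤own o o′))
        by-cases (yes refl) (yes o~o)  = shared o~o (≤-trans (fraction-kernel≤ o o)
          (subst₂ _≤_ (trans (+-identityˡ _) (when-yes (o ≟ᵒ o) refl))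
              refl (+-monoˡ-≤ (own o o) 0≤waits)))
        by-cases _          (no o≁o′)  = ≤-respˡ
          (sym (trans (cong (λ z → f * z * k) (when-no (machine o Fin.≟ machine o′) o≁o′))
            (solve 2 (λ f k → f :* :0 :* k := :0) refl f k)))
          (0≤+ 0≤waits (0≤own o o′))

      -- Each pair occurs in both orders, so the waits amount to at most twice the weighted start
      -- times; the diagonal adds the running times, which completes `doubledMidpoint`.
      ∑∑-shared-kernel≤ : ∑∑ ops shared-kernel ≤ ∑ ops λ o → fraction o * doubledMidpoint o
      ∑∑-shared-kernel≤ = ≤-trans (∑∑-mono ops shared-kernel≤) (≤-respˡ
        (sym (trans (∑∑-+ ops _ own) (cong₂ _+_
          (trans (∑∑-+ ops wait _) (cong (∑∑ ops wait +_) (sym (∑-swap ops ops wait))))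
          (∑-cong ops λ o → ∑-ops-point o _))))
        (≤-respʳ
          (trans (cong (_+ ∑ ops (λ o → fraction o * runningTime o)) (sym (∑-+ ops _ _)))
            (trans (sym (∑-+ ops _ _)) (∑-cong ops λ o →
              solve 3 (λ f s r → f :* s :+ f :* s :+ f :* r := f :* (s :+ s :+ r)) refl
                (fraction o) (start o) (runningTime o))))
          (+-monoˡ-≤ _ (+-mono-≤ ∑∑-wait≤ ∑∑-wait≤))))
        where
        ∑∑-wait≤ : ∑∑ ops wait ≤ ∑ ops λ o → fraction o * start o
        ∑∑-wait≤ = ∑-mono ops λ o → subst (_≤ fraction o * start o)
          (sym (∑-*ˡ ops (fraction o) _)) (*-monoˡ-≤ (0≤fraction o) (∑-preceding o))

      ∑∑-kernel≤ : ∑∑ ops (λ o o′ → fraction o * fraction o′ * kernel o o′)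
        ≤ fromℕ m * ∑∑ ops shared-kernel
      ∑∑-kernel≤ = difference-≤
        (trans (+-congʳ (sym (∑∑-*ˡ ops (fromℕ m) _)))
          (trans (solve 2 (λ u v → u :- v := u :+ (:- :1) :* v :- :0) refl _ _)
            (cong (_- 0#) (trans (cong (∑∑ ops (λ o o′ → fromℕ m * shared-kernel o o′) +_) (sym (∑∑-*ˡ ops (- 1#) _)))
              (trans (sym (∑∑-+ ops _ _)) (∑∑-cong ops λ o o′ →
              solve 5 (λ f g m s k → m :* (f :* g :* s :* k) :+ (:- :1) :* (f :* g :* k) := f :* g :* (m :* s :- :1) :* k) refl
                (fraction o) (fraction o′) (fromℕ m) (1# when machine o Fin.≟ machine o′) (kernel o o′)))))))
        (∑∑-⊓-nonNeg (q ∘ job) (0≤q ∘ job)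
          (λ o o′ → fraction o * fraction o′ * (fromℕ m * (1# when machine o Fin.≟ machine o′) - 1#))
          (∑∑-shared-nonNeg machine fraction) ops)

      -- The two fractions of a job add up to 1 unless its length is 0, and then the kernel vanishes
      -- as well.
      ∑∑-jobs-kernel : ∑∑ ops (λ o o′ → fraction o * fraction o′ * kernel o o′) ≡ ∑∑ jobs λ i j → q i ⊓ q j
      ∑∑-jobs-kernel = trans (∑-ops _) (trans
        (∑-cong jobs λ i → trans (cong₂ _+_ (∑-ops _) (∑-ops _)) (sym (∑-+ jobs _ _)))
        (∑∑-cong jobs λ i j → trans
          (solve 7 (λ t p a t′ p′ a′ k →
            (t :* a :* (t′ :* a′) :* k :+ t :* a :* (p′ :* a′) :* k) :+
            (p :* a :* (t′ :* a′) :* k :+ p :* a :* (p′ :* a′) :* k) :=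
            ((t :+ p) :* a) :* ((t′ :+ p′) :* a′) :* k) refl
            (t i) (p i) (q⁻¹ i) (t j) (p j) (q⁻¹ j) (q i ⊓ q j))
          (full i j)))
        where
        zero-kernel : ∀ i j z → q i ⊓ q j ≤ 0# → z * (q i ⊓ q j) ≡ q i ⊓ q j
        zero-kernel i j z le = trans (cong (z *_) eq) (trans (zeroʳ z) (sym eq))
          where
          eq : q i ⊓ q j ≡ 0#
          eq = ≤-antisym le (0≤⊓ i j)
        full : ∀ i j → q i * q⁻¹ i * (q j * q⁻¹ j) * (q i ⊓ q j) ≡ q i ⊓ q j
        full i j with q i ≟ᶜ 0# | q j ≟ᶜ 0#
        ... | yes qi≡0 | _        = zero-kernel i j _ (subst (q i ⊓ q j ≤_) qi≡0 (x⊓y≤x _ _))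
        ... | no _     | yes qj≡0 = zero-kernel i j _ (subst (q i ⊓ q j ≤_) qj≡0 (x⊓y≤y _ _))
        ... | no qi≢0  | no qj≢0  = trans
          (cong₂ (λ u v → u * v * (q i ⊓ q j)) (*-inverseʳ qi≢0) (*-inverseʳ qj≢0))
          (solve 1 (λ k → :1 :* :1 :* k := k) refl (q i ⊓ q j))

    -- The sum of the minima plays the role of `2 OPT₁ - Q`. In this form the bound serves twice:
    -- for m machines, and at m = 1 to prove that shortest-first is optimal.
    eastman-even-isaacs : ∑∑ jobs (λ i j → q i ⊓ q j) + fromℕ m * Q
      ≤ fromℕ m * (totalCompletionTime + totalCompletionTime)
    eastman-even-isaacs = difference-≤
      (solve 4 (λ k m q c → m :* (c :+ c) :- (k :+ m :* q) := m :* (c :+ c :- q) :- k) refl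
        (∑∑ jobs λ i j → q i ⊓ q j) (fromℕ m) Q totalCompletionTime)
      (≤-trans (≤-reflexive (sym ∑∑-jobs-kernel)) (≤-trans ∑∑-kernel≤
        (*-monoˡ-≤ (0≤fromℕ m) (≤-trans ∑∑-shared-kernel≤ (subst₂ _≤_ (sym (∑-ops _)) total
          (∑-mono jobs job-midpoint))))))
      where
      total : ∑ jobs (λ j → end (π j) + end (π j) - q j) ≡ totalCompletionTime + totalCompletionTime - Q
      total = trans (∑-cong jobs λ j → solve 2 (λ e q → e :+ e :- q := e :+ e :+ (:- :1) :* q)
          refl (end (π j)) (q j))
        (trans (∑-+ jobs _ _) (trans (cong₂ _+_
          (trans (∑-+ jobs _ _) (cong (λ z → z + z) (∑-allFin N _)))
          (∑-*ˡ jobs (- 1#) q))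
          (solve 2 (λ c q → c :+ c :+ (:- :1) :* q := c :+ c :- q) refl totalCompletionTime Q)))

  -- The shortest-job-first schedule on one machine.

  private
    -- The index breaks ties, so that any two distinct jobs are strictly ordered even if their
    -- lengths agree.
    ⊑-order : DecTotalOrder _ _ _
    ⊑-order = On.decTotalOrder (×-decTotalOrder decTotalOrder (Fin.≤-decTotalOrder N)) (λ j → q j , j)

    open DecTotalOrder ⊑-order using ()
      renaming (_≤_ to _⊑_; _≤?_ to _⊑?_; total to ⊑-total; trans to ⊑-trans; antisym to ⊑-antisym′)

    ⊑-antisym : ∀ {i j} → i ⊑ j → j ⊑ i → i ≡ j
    ⊑-antisym i⊑j j⊑i = proj₂ (⊑-antisym′ i⊑j j⊑i)

    ⊑⇒q≤ : ∀ {i j} → i ⊑ j → q i ≤ q j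
    ⊑⇒q≤ (inj₁ (qi≤qj , _)) = qi≤qj
    ⊑⇒q≤ (inj₂ (qi≡qj , _)) = ≤-reflexive qi≡qj

    _⊏_ : Fin N → Fin N → Set _
    i ⊏ j = i ≢ j × i ⊑ j

    _⊏?_ : ∀ i j → Dec (i ⊏ j)
    i ⊏? j = ¬? (i Fin.≟ j) ×-dec i ⊑? j

    ⊏-asym : ∀ {i j} → i ⊏ j → ¬ j ⊏ i
    ⊏-asym (i≢j , i⊑j) (_ , j⊑i) = i≢j (⊑-antisym i⊑j j⊑i)

    ⊏-trans : ∀ {i j k} → i ⊏ j → j ⊏ k → i ⊏ k
    ⊏-trans {i} (i≢j , i⊑j) (j≢k , j⊑k) =
      (λ { refl → i≢j (⊑-antisym i⊑j j⊑k) }) , ⊑-trans {i} i⊑j j⊑k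

    begins : Fin N → Carrier
    begins j = ∑ jobs λ i → q i when i ⊏? j

    0≤begins : ∀ j → 0# ≤ begins j
    0≤begins j = ∑-nonNeg jobs λ i → 0≤when (i ⊏? j) (0≤q i)

    begins-⊏ : ∀ {i j} → i ⊏ j → begins i + q i ≤ begins j
    begins-⊏ {i} {j} i⊏j = ≤-respˡ (trans (∑-+ jobs _ _) (cong (begins i +_) (∑-jobs-point i (q i))))
      (∑-mono jobs λ k → pointwise k (k ⊏? i) (i Fin.≟ k))
      where
      pointwise : ∀ k → Dec (k ⊏ i) → Dec (i ≡ k) → (q k when k ⊏? i) + (q i when i Fin.≟ k) ≤ (q k when k ⊏? j)
      pointwise k (yes k⊏i) _ = ≤-reflexive (trans
        (cong₂ _+_ (when-yes (k ⊏? i) k⊏i) (when-no (i Fin.≟ k) (proj₁ k⊏i ∘ sym)))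
        (trans (+-identityʳ (q k)) (sym (when-yes (k ⊏? j) (⊏-trans k⊏i i⊏j)))))
      pointwise k (no k⊏̸i) (yes refl) = ≤-reflexive (trans
        (cong₂ _+_ (when-no (k ⊏? i) k⊏̸i) (when-yes (i Fin.≟ k) refl))
        (trans (+-identityˡ (q k)) (sym (when-yes (k ⊏? j) i⊏j))))
      pointwise k (no k⊏̸i) (no i≢k) = ≤-respˡ
        (sym (trans (cong₂ _+_ (when-no (k ⊏? i) k⊏̸i) (when-no (i Fin.≟ k) i≢k)) (+-identityˡ 0#)))
        (0≤when (k ⊏? j) (0≤q k))

    spt-start : Operation N → Carrier
    spt-start (τ j) = begins j
    spt-start (π j) = begins j + t j

    begins≤spt-start : ∀ o → begins (job o) ≤ spt-start o
    begins≤spt-start (τ j) = ≤-refl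
    begins≤spt-start (π j) = ≤-plus (0≤t j)

    spt-end≤ : ∀ o → spt-start o + runningTime o ≤ begins (job o) + q (job o)
    spt-end≤ (τ j) = difference-≤ (solve 3 (λ b t p → (b :+ (t :+ p)) :- (b :+ t) := p :- :0)
        refl (begins j) (t j) (p j)) (0≤p j)
    spt-end≤ (π j) = ≤-reflexive (+-assoc (begins j) (t j) (p j))

    spt-⊏ : ∀ o o′ → job o ⊏ job o′ → spt-start o + runningTime o ≤ spt-start o′
    spt-⊏ o o′ o⊏o′ = ≤-trans (spt-end≤ o) (≤-trans (begins-⊏ o⊏o′) (begins≤spt-start o′))

    spt-disjoint : ∀ o o′ → o ≢ o′ →
      spt-start o + runningTime o ≤ spt-start o′ ⊎ spt-start o′ + runningTime o′ ≤ spt-start o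
    spt-disjoint o o′ o≢o′ with job o Fin.≟ job o′ | ⊑-total (job o) (job o′)
    ... | no i≢j | inj₁ i⊑j = inj₁ (spt-⊏ o o′ (i≢j , i⊑j))
    ... | no i≢j | inj₂ j⊑i = inj₂ (spt-⊏ o′ o (i≢j ∘ sym , j⊑i))
    ... | yes i≡j | _ = same-job o o′ i≡j o≢o′
      where
      same-job : ∀ o o′ → job o ≡ job o′ → o ≢ o′ →
        spt-start o + runningTime o ≤ spt-start o′ ⊎ spt-start o′ + runningTime o′ ≤ spt-start o
      same-job (τ i) (τ .i) refl o≢o = contradiction refl o≢o
      same-job (τ i) (π .i) refl _   = inj₁ ≤-refl
      same-job (π i) (τ .i) refl _   = inj₂ ≤-refl
      same-job (π i) (π .i) refl o≢o = contradiction refl o≢o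

    spt : Schedule I 1
    spt = record
      { machine   = λ _ → zero
      ; start     = spt-start
      ; 0≤start   = λ o → ≤-trans (0≤begins (job o)) (begins≤spt-start o)
      ; testFirst = λ j → ≤-refl
      ; noOverlap = λ o o′ o≢o′ _ → spt-disjoint o o′ o≢o′
      }

  opt₁ : Carrier
  opt₁ = Schedule.totalCompletionTime spt

  private
    opt₁-expand : opt₁ ≡ ∑ jobs begins + Q
    opt₁-expand = trans (sym (∑-allFin N _))
      (trans (∑-cong jobs λ j → +-assoc (begins j) (t j) (p j)) (∑-+ jobs begins q))

    -- For distinct jobs exactly one of the two orders holds, and it contributes the shorter length;
    -- the diagonal contributes `Q`.
    begins-⊓ : ∑ jobs begins + ∑ jobs begins + Q ≤ ∑∑ jobs λ i j → q i ⊓ q j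
    begins-⊓ = ≤-respˡ
      (trans (∑∑-+ jobs _ _) (cong₂ _+_
        (trans (∑∑-+ jobs _ _) (cong (∑ jobs begins +_) (∑-swap jobs jobs λ j i → q j when j ⊏? i)))
        (∑-cong jobs λ j → ∑-jobs-point j (q j))))
      (∑∑-mono jobs λ j i → pointwise j i (j Fin.≟ i) (⊑-total j i))
      where
      pointwise : ∀ j i → Dec (j ≡ i) → j ⊑ i ⊎ i ⊑ j →
        (q i when i ⊏? j) + (q j when j ⊏? i) + (q j when j Fin.≟ i) ≤ q j ⊓ q i
      pointwise j .j (yes refl) _ = ≤-respˡ
        (sym (trans (cong₂ _+_ (cong₂ _+_ (when-no (j ⊏? j) (λ j⊏j → proj₁ j⊏j refl)) (when-no (j ⊏? j) (λ j⊏j → proj₁ j⊏j refl)))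
          (when-yes (j Fin.≟ j) refl)) (solve 1 (λ q → :0 :+ :0 :+ q := q) refl (q j))))
        (⊓-glb ≤-refl ≤-refl)
      pointwise j i (no j≢i) (inj₁ j⊑i) = ≤-respˡ
        (sym (trans (cong₂ _+_ (cong₂ _+_ (when-no (i ⊏? j) (⊏-asym (j≢i , j⊑i))) (when-yes (j ⊏? i) (j≢i , j⊑i)))
          (when-no (j Fin.≟ i) j≢i)) (solve 1 (λ q → :0 :+ q :+ :0 := q) refl (q j))))
        (⊓-glb ≤-refl (⊑⇒q≤ j⊑i))
      pointwise j i (no j≢i) (inj₂ i⊑j) = ≤-respˡ
        (sym (trans (cong₂ _+_ (cong₂ _+_ (when-yes (i ⊏? j) (j≢i ∘ sym , i⊑j)) (when-no (j ⊏? i) (⊏-asym (j≢i ∘ sym , i⊑j))))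
          (when-no (j Fin.≟ i) j≢i)) (solve 1 (λ q → q :+ :0 :+ :0 := q) refl (q i))))
        (⊓-glb (⊑⇒q≤ i⊑j) ≤-refl)

  Q≤opt₁ : Q ≤ opt₁
  Q≤opt₁ = ≤-respʳ (trans (+-comm Q _) (sym opt₁-expand)) (≤-plus (∑-nonNeg jobs 0≤begins))

  private
    opt₁-⊓ : opt₁ + opt₁ ≤ ∑∑ jobs (λ i j → q i ⊓ q j) + Q
    opt₁-⊓ = difference-≤
      (trans (cong (λ a → ∑∑ jobs (λ i j → q i ⊓ q j) + Q - (a + a)) opt₁-expand)
        (solve 3 (λ k q b → k :+ q :- (b :+ q :+ (b :+ q)) := k :- (b :+ b :+ q)) refl
          (∑∑ jobs λ i j → q i ⊓ q j) Q (∑ jobs begins)))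
      begins-⊓

  -- At m = 1 the general bound says that twice the cost of any schedule is at least the sum of the
  -- minima plus `Q`, and `spt` stays within that value.
  opt₁-isOPT : IsOPT I 1 opt₁
  opt₁-isOPT = record
    { attained = spt , refl
    ; minimal  = λ S → +-halve-≤ (≤-trans opt₁-⊓ (difference-≤
        -- `:1 :+ :0` is the unfolded `fromℕ 1`.
        (solve 3 (λ k q c → (c :+ c) :- (k :+ q) := (:1 :+ :0) :* (c :+ c) :- (k :+ (:1 :+ :0) :* q)) refl
          (∑∑ jobs λ i j → q i ⊓ q j) Q (Schedule.totalCompletionTime S))
        (eastman-even-isaacs S)))
    }

  opt₁-parallel : ∀ {m opt} → IsOPT I m opt →
    opt₁ + opt₁ + fromℕ m * Q ≤ fromℕ m * (opt + opt) + Q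
  opt₁-parallel {m} record { attained = S , refl } =
    (≤-trans (+-monoˡ-≤ (fromℕ m * Q) opt₁-⊓) (difference-≤
      (solve 4 (λ k m q c → (m :* (c :+ c) :+ q) :- (k :+ q :+ m :* q) := m :* (c :+ c) :- (k :+ m :* q)) refl
        (∑∑ jobs λ i j → q i ⊓ q j) (fromℕ m) Q (Schedule.totalCompletionTime S))
      (eastman-even-isaacs S)))

AllPairs-++⁻ : ∀ {a r} {A : Set a} {R : A → A → Set r} xs {ys} → AllPairs R (xs ++ ys) →
  ∀ {x y} → x ∈ xs → y ∈ ys → R x y
AllPairs-++⁻ (x ∷ xs) (rs ∷ _) (here refl) y∈ = All.lookup rs (∈-++⁺ʳ xs y∈)
AllPairs-++⁻ (x ∷ xs) (_ ∷ p)  (there x∈)  y∈ = AllPairs-++⁻ xs p x∈ y∈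

∈-drop⇒length-take : ∀ {a} {A : Set a} n (xs : List A) {x} → x ∈ drop n xs → length (take n xs) ≡ n
∈-drop⇒length-take zero    xs       _  = refl
∈-drop⇒length-take (suc n) (x ∷ xs) x∈ = cong suc (∈-drop⇒length-take n xs x∈)

-- The course of 1-SORT on any number of machines.

module Run {c ℓ r} (F : OrderedField c ℓ) (tie : Scheduling.TieRule F r) (m : ℕ)
           (I : Scheduling.Instance F) where
  open OrderedField F
  open FieldProperties F
  open Inequalities F
  open Scheduling F
  open Instance I
  open Offline F I
  open 1-SORT tie m I
  open import Data.List.Membership.DecPropositional (_≟ᵒ_ {N}) using (_∈?_)

  open DecTotalOrder priority public using ()
    renaming (_≤_ to _≼_; _≤?_ to _≼?_; total to ≼-total; trans to ≼-trans; refl to ≼-refl)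

  ≼-antisym : ∀ {x y} → x ≼ y → y ≼ x → x ≡ y
  ≼-antisym {x} {y} x≼y y≼x = proj₂ (DecTotalOrder.antisym priority {x} {y} x≼y y≼x)

  module _ (σ : State) where

    private
      open InsertionSort priority using (sort)
      open InsertionSortProperties priority using (sort-↭; sort-↗)

      availables queue : List (Operation N)
      availables = filterᵇ (isAvailable ∘ σ) (operations N)
      queue = sort availables

      ∈-queue⁺ : ∀ {o} → σ o ≡ available → o ∈ queue
      ∈-queue⁺ {o} eq = ∈-resp-↭ (↭-sym (sort-↭ availables))
        (∈-filter⁺ (T? ∘ isAvailable ∘ σ) (∈-operations o) (subst (T ∘ isAvailable) (sym eq) _))

      ∈-queue⁻ : ∀ {o} → o ∈ queue → σ o ≡ available
      ∈-queue⁻ {o} o∈ = is-available (proj₂ (∈-filter⁻ (T? ∘ isAvailable ∘ σ) {xs = operations N}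
        (∈-resp-↭ (sort-↭ availables) o∈)))
        where
        is-available : T (isAvailable (σ o)) → σ o ≡ available
        is-available _ with σ o
        ... | available = refl

      ∈-rest : ∀ {o} → σ o ≡ available → o ∉ chosen σ → o ∈ drop (idle σ) queue
      ∈-rest {o} eq o∉ with ∈-++⁻ (chosen σ) (subst (o ∈_) (sym (take++drop≡id (idle σ) queue)) (∈-queue⁺ eq))
      ... | inj₁ o∈ = contradiction o∈ o∉
      ... | inj₂ o∈ = o∈

    chosen⇒available : ∀ {o} → o ∈ chosen σ → σ o ≡ available
    chosen⇒available {o} o∈ = ∈-queue⁻ (subst (o ∈_) (take++drop≡id (idle σ) queue) (∈-++⁺ˡ o∈))

    chosen-minimal : ∀ {x y} → x ∈ chosen σ → σ y ≡ available → y ∉ chosen σ → x ≼ y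
    chosen-minimal x∈ eq y∉ = AllPairs-++⁻ (chosen σ)
      (subst (AllPairs _≼_) (sym (take++drop≡id (idle σ) queue))
        (Sorted⇒AllPairs (DecTotalOrder.totalOrder priority) (sort-↗ availables)))
      x∈ (∈-rest eq y∉)

    -- A nonempty remainder of the queue means that `take` found enough operations for every idle
    -- machine.
    length-chosen : ∀ {y} → σ y ≡ available → y ∉ chosen σ → length (chosen σ) ≡ idle σ
    length-chosen eq y∉ = ∈-drop⇒length-take (idle σ) queue (∈-rest eq y∉)

    length-chosen≤ : length (chosen σ) ℕ.≤ idle σ
    length-chosen≤ = subst (ℕ._≤ idle σ) (sym (length-take (idle σ) queue)) (ℕ.m⊓n≤m _ _)

    chosen-unique : Unique (chosen σ)
    chosen-unique = Unique.take⁺ (idle σ)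
      (SetoidPermutation.Unique-resp-↭ (setoid _) (↭⇒↭ₛ (↭-sym (sort-↭ availables)))
        (Unique.filter⁺ (T? ∘ isAvailable ∘ σ) (operations-unique N)))

  -- Valued in the field, so that the number of busy machines can be multiplied by a duration in
  -- `work-advance`.
  running# : Status → Carrier
  running# (runningUntil _) = 1#
  running# _                = 0#

  0≤running# : ∀ s → 0# ≤ running# s
  0≤running# unavailable      = ≤-refl
  0≤running# available        = ≤-refl
  0≤running# (runningUntil _) = 0≤1
  0≤running# (completedAt _)  = ≤-refl

  count : State → Carrier
  count σ = ∑ ops (running# ∘ σ)

  count-ends : ∀ σ → count σ ≡ fromℕ (length (ends σ))
  count-ends σ = go (operations N)
    where
    go : ∀ xs → ∑ xs (running# ∘ σ) ≡ fromℕ (length (mapMaybe (endOfRun ∘ σ) xs))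
    go [] = refl
    go (x ∷ xs) with σ x
    ... | unavailable    = trans (+-identityˡ _) (go xs)
    ... | available      = trans (+-identityˡ _) (go xs)
    ... | runningUntil _ = cong (1# +_) (go xs)
    ... | completedAt _  = trans (+-identityˡ _) (go xs)

  ∈-ends⁺ : ∀ {σ o e} → σ o ≡ runningUntil e → e ∈ ends σ
  ∈-ends⁺ {σ} {o} {e} eq = go (∈-operations o)
    where
    go : ∀ {xs} → o ∈ xs → e ∈ mapMaybe (endOfRun ∘ σ) xs
    go (here refl) rewrite eq = here refl
    go {x ∷ xs} (there o∈) with endOfRun (σ x)
    ... | just _  = there (go o∈)
    ... | nothing = go o∈

  ∈-ends⁻ : ∀ {σ e} → e ∈ ends σ → ∃[ o ] σ o ≡ runningUntil e
  ∈-ends⁻ {σ} {e} = go (operations N)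
    where
    go : ∀ xs → e ∈ mapMaybe (endOfRun ∘ σ) xs → ∃[ o ] σ o ≡ runningUntil e
    go (x ∷ xs) e∈ with σ x in eq
    ... | unavailable   = go xs e∈
    ... | available     = go xs e∈
    ... | completedAt _ = go xs e∈
    go (x ∷ xs) (here refl) | runningUntil _ = x , eq
    go (x ∷ xs) (there e∈)  | runningUntil _ = go xs e∈

  nextEvent-nothing : ∀ {σ} → nextEvent σ ≡ nothing → ∀ o e → σ o ≢ runningUntil e
  nextEvent-nothing {σ} eq o e running with ends σ | ∈-ends⁺ {σ} running
  nextEvent-nothing {σ} () o e running | _ ∷ _ | _

  nextEvent-earliest : ∀ {σ now} → nextEvent σ ≡ just now → ∀ o e → σ o ≡ runningUntil e → now ≤ e
  nextEvent-earliest {σ} eq o e running with ends σ | ∈-ends⁺ {σ} running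
  nextEvent-earliest refl o e running | e₀ ∷ es | here refl = Extrema.min≤⊤ totalOrder e₀ es
  nextEvent-earliest refl o e running | e₀ ∷ es | there e∈ = All.lookup (Extrema.min≤xs totalOrder e₀ es) e∈

  nextEvent-attained : ∀ {σ now} → nextEvent σ ≡ just now → ∃[ o ] σ o ≡ runningUntil now
  nextEvent-attained {σ} {now} eq = ∈-ends⁻ {σ} (attained eq)
    where
    attained : nextEvent σ ≡ just now → now ∈ ends σ
    attained eq with ends σ
    attained refl | e₀ ∷ es with Extrema.argmin-sel totalOrder id e₀ es
    ... | inj₁ eq = here eq
    ... | inj₂ e∈ = there e∈

  -- Of the sixteen pairs of statuses of a test and its execution, only these five are reachable.
  data Phase : Status → Status → Set c where
    untested  : Phase available unavailable
    testing   : ∀ e → Phase (runningUntil e) unavailable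
    tested    : ∀ e → Phase (completedAt e) available
    executing : ∀ e e′ → Phase (completedAt e) (runningUntil e′)
    done      : ∀ e e′ → Phase (completedAt e) (completedAt e′)

  -- One event as seen by one job. The statuses before and after are indices, so one match settles
  -- all four. In `continue` the test completes and its execution starts within the same event.
  data Step (now : Carrier) (Chosen : Operation N → Set) (i : Fin N) :
       (τ-before π-before τ-after π-after : Status) → Set (c ⊔ ℓ) where
    untested  : ¬ Chosen (τ i) → Step now Chosen i available unavailable available unavailable
    test      : Chosen (τ i) → Step now Chosen i available unavailable (runningUntil (now + t i)) unavailable
    testing   : ∀ {e} → ¬ e ≤ now → Step now Chosen i (runningUntil e) unavailable (runningUntil e) unavailable
    reveals   : ∀ {e} → e ≤ now → ¬ Chosen (π i) →
                Step now Chosen i (runningUntil e) unavailable (completedAt e) available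
    continue  : ∀ {e} → e ≤ now → Chosen (π i) →
                Step now Chosen i (runningUntil e) unavailable (completedAt e) (runningUntil (now + p i))
    tested    : ∀ {e} → ¬ Chosen (π i) → Step now Chosen i (completedAt e) available (completedAt e) available
    execute   : ∀ {e} → Chosen (π i) →
                Step now Chosen i (completedAt e) available (completedAt e) (runningUntil (now + p i))
    executing : ∀ {e e′} → ¬ e′ ≤ now →
                Step now Chosen i (completedAt e) (runningUntil e′) (completedAt e) (runningUntil e′)
    finish    : ∀ {e e′} → e′ ≤ now →
                Step now Chosen i (completedAt e) (runningUntil e′) (completedAt e) (completedAt e′)
    done      : ∀ {e e′} → Step now Chosen i (completedAt e) (completedAt e′) (completedAt e) (completedAt e′)

  revealed : Carrier → State → State
  revealed now σ = reveal (complete now σ)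

  Starts : Carrier → State → Operation N → Set
  Starts now σ o = o ∈ chosen (revealed now σ)

  startChosen-yes : ∀ now σ {o} → o ∈ chosen σ → startChosen now σ o ≡ runningUntil (now + runningTime o)
  startChosen-yes now σ {o} o∈ with o ∈? chosen σ
  ... | yes _  = refl
  ... | no  o∉ = contradiction o∈ o∉

  startChosen-no : ∀ now σ {o} → o ∉ chosen σ → startChosen now σ o ≡ σ o
  startChosen-no now σ {o} o∉ with o ∈? chosen σ
  ... | yes o∈ = contradiction o∈ o∉
  ... | no  _  = refl

  not-chosen : ∀ {σ o s} → σ o ≡ s → s ≢ available → o ∉ chosen σ
  not-chosen {σ} eq s≢ o∈ = s≢ (trans (sym eq) (chosen⇒available σ o∈))

  complete-other : ∀ {now σ o s} → σ o ≡ s → (∀ e → s ≢ runningUntil e) → complete now σ o ≡ s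
  complete-other {σ = σ} {o} eq not-running with σ o
  ... | unavailable    = eq
  ... | available      = eq
  ... | runningUntil e = contradiction (sym eq) (not-running e)
  ... | completedAt _  = eq

  complete-late : ∀ {now σ o e} → σ o ≡ runningUntil e → ¬ e ≤ now → complete now σ o ≡ runningUntil e
  complete-late {now} {σ} {o} {e} eq e≰now rewrite eq with e ≤? now
  ... | yes e≤now = contradiction e≤now e≰now
  ... | no  _     = refl

  complete-due : ∀ {now σ o e} → σ o ≡ runningUntil e → e ≤ now → complete now σ o ≡ completedAt e
  complete-due {now} {σ} {o} {e} eq e≤now rewrite eq with e ≤? now
  ... | yes _     = refl
  ... | no  e≰now = contradiction e≤now e≰now

  reveal-other : ∀ {σ i s} → σ (π i) ≡ s → s ≢ unavailable → reveal σ (π i) ≡ s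
  reveal-other {σ} {i} eq s≢ with σ (π i) | σ (τ i)
  ... | unavailable    | _ = contradiction (sym eq) s≢
  ... | available      | _ = eq
  ... | runningUntil _ | _ = eq
  ... | completedAt _  | _ = eq

  reveal-hidden : ∀ {σ i s} → σ (π i) ≡ unavailable → σ (τ i) ≡ s → (∀ e → s ≢ completedAt e) →
    reveal σ (π i) ≡ unavailable
  reveal-hidden {σ} {i} eq eqτ not-completed rewrite eq with σ (τ i)
  ... | unavailable    = refl
  ... | available      = refl
  ... | runningUntil _ = refl
  ... | completedAt e  = contradiction (sym eqτ) (not-completed e)

  reveal-reveals : ∀ {σ i e} → σ (π i) ≡ unavailable → σ (τ i) ≡ completedAt e → reveal σ (π i) ≡ available
  reveal-reveals eq eqτ rewrite eq | eqτ = refl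

  event-step : ∀ now σ i → Phase (σ (τ i)) (σ (π i)) →
    Step now (Starts now σ) i (σ (τ i)) (σ (π i)) (event now σ (τ i)) (event now σ (π i))
  event-step now σ i phase =
    go phase refl refl (τ i ∈? chosen (revealed now σ)) (π i ∈? chosen (revealed now σ)) (_≤? now)
    where
    ρ : State
    ρ = revealed now σ

    stays : ∀ {o s} → ρ o ≡ s → s ≢ available → event now σ o ≡ s
    stays eq s≢ = trans (startChosen-no now ρ (not-chosen eq s≢)) eq

    assemble : ∀ {a b u v} → event now σ (τ i) ≡ u → event now σ (π i) ≡ v →
      Step now (Starts now σ) i a b u v → Step now (Starts now σ) i a b (event now σ (τ i)) (event now σ (π i))
    assemble refl refl = id

    go : ∀ {a b} → Phase a b → σ (τ i) ≡ a → σ (π i) ≡ b →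
      Dec (τ i ∈ chosen ρ) → Dec (π i ∈ chosen ρ) → (∀ e → Dec (e ≤ now)) →
      Step now (Starts now σ) i a b (event now σ (τ i)) (event now σ (π i))
    go untested eqτ eqπ (yes τ∈) _ _ = assemble (startChosen-yes now ρ τ∈)
      (stays (reveal-hidden {complete now σ} (complete-other {now} {σ} eqπ λ _ ())
        (complete-other {now} {σ} eqτ λ _ ()) λ _ ()) λ ())
      (test τ∈)
    go untested eqτ eqπ (no τ∉) _ _ = assemble
      (trans (startChosen-no now ρ τ∉) (complete-other {now} {σ} eqτ λ _ ()))
      (stays (reveal-hidden {complete now σ} (complete-other {now} {σ} eqπ λ _ ())
        (complete-other {now} {σ} eqτ λ _ ()) λ _ ()) λ ())
      (untested τ∉)
    go (testing e) eqτ eqπ _ dπ due? with due? e | dπ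
    ... | no e≰now  | _ = assemble (stays late λ ())
      (stays (reveal-hidden {complete now σ} (complete-other {now} {σ} eqπ λ _ ()) late λ _ ()) λ ())
      (testing e≰now)
      where
      late : complete now σ (τ i) ≡ runningUntil e
      late = complete-late {now} {σ} eqτ e≰now
    ... | yes e≤now | yes π∈ = assemble (stays (complete-due {now} {σ} eqτ e≤now) λ ())
      (startChosen-yes now ρ π∈) (continue e≤now π∈)
    ... | yes e≤now | no π∉ = assemble (stays due λ ())
      (trans (startChosen-no now ρ π∉)
        (reveal-reveals {complete now σ} (complete-other {now} {σ} eqπ λ _ ()) due))
      (reveals e≤now π∉)
      where
      due : complete now σ (τ i) ≡ completedAt e
      due = complete-due {now} {σ} eqτ e≤now
    go (tested e) eqτ eqπ _ (yes π∈) _ = assemble (stays (complete-other {now} {σ} eqτ λ _ ()) λ ())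
      (startChosen-yes now ρ π∈) (execute π∈)
    go (tested e) eqτ eqπ _ (no π∉) _ = assemble (stays (complete-other {now} {σ} eqτ λ _ ()) λ ())
      (trans (startChosen-no now ρ π∉)
        (reveal-other {complete now σ} (complete-other {now} {σ} eqπ λ _ ()) λ ()))
      (tested π∉)
    go (executing e e′) eqτ eqπ _ _ due? with due? e′
    ... | no e′≰now = assemble (stays (complete-other {now} {σ} eqτ λ _ ()) λ ())
      (stays (reveal-other {complete now σ} (complete-late {now} {σ} eqπ e′≰now) λ ()) λ ())
      (executing e′≰now)
    ... | yes e′≤now = assemble (stays (complete-other {now} {σ} eqτ λ _ ()) λ ())
      (stays (reveal-other {complete now σ} (complete-due {now} {σ} eqπ e′≤now) λ ()) λ ())
      (finish e′≤now)
    go (done e e′) eqτ eqπ _ _ _ = assemble (stays (complete-other {now} {σ} eqτ λ _ ()) λ ())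
      (stays (reveal-other {complete now σ} (complete-other {now} {σ} eqπ λ _ ()) λ ()) λ ()) done

  starts⇒running : ∀ {now σ o} → Starts now σ o → event now σ o ≡ runningUntil (now + runningTime o)
  starts⇒running {now} {σ} = startChosen-yes now (revealed now σ)

  waits : ∀ {now σ y} → event now σ y ≡ available → ¬ Starts now σ y × revealed now σ y ≡ available
  waits {now} {σ} {y} eq = y∉ , trans (sym (startChosen-no now (revealed now σ) y∉)) eq
    where
    y∉ : ¬ Starts now σ y
    y∉ y∈ with () ← trans (sym (starts⇒running {now} {σ} y∈)) eq

  starts-minimal : ∀ {now σ x y} → Starts now σ x → event now σ y ≡ available → x ≼ y
  starts-minimal {now} {σ} x∈ eq = let (y∉ , eq′) = waits {now} {σ} eq in
    chosen-minimal (revealed now σ) x∈ eq′ y∉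

  ∑-member : ∀ {xs} → Unique xs → ∑ ops (λ o → 1# when o ∈? xs) ≡ fromℕ (length xs)
  ∑-member {xs} unique = trans (∑-cong ops λ o → pointwise o (o ∈? xs))
    (trans (∑-swap ops xs λ o o′ → 1# when o ≟ᵒ o′)
      (trans (∑-cong xs λ o → trans (∑-cong ops λ o′ → flip o′ o (o ≟ᵒ o′)) (∑-ops-point o 1#))
        (trans (∑-const xs 1#) (*-identityʳ _))))
    where
    pointwise : ∀ o → Dec (o ∈ xs) → (1# when o ∈? xs) ≡ ∑ xs λ o′ → 1# when o ≟ᵒ o′
    pointwise o (yes o∈) = trans (when-yes (o ∈? xs) o∈) (sym (∑-point _≟ᵒ_ 1# unique o∈))
    pointwise o (no o∉)  = trans (when-no (o ∈? xs) o∉) (sym (∑-point-∉ _≟ᵒ_ o∉))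
    flip : ∀ o o′ → Dec (o′ ≡ o) → (1# when o ≟ᵒ o′) ≡ (1# when o′ ≟ᵒ o)
    flip o o′ (yes refl) = refl
    flip o o′ (no o′≢o)  = trans (when-no (o ≟ᵒ o′) (o′≢o ∘ sym)) (sym (when-no (o′ ≟ᵒ o) o′≢o))

  count-startChosen : ∀ now σ → count (startChosen now σ) ≡ fromℕ (length (ends σ) ℕ.+ length (chosen σ))
  count-startChosen now σ = trans (∑-cong ops λ o → pointwise o (o ∈? chosen σ))
    (trans (∑-+ ops _ _) (trans (cong₂ _+_ (count-ends σ) (∑-member (chosen-unique σ)))
      (sym (fromℕ-+ (length (ends σ)) (length (chosen σ))))))
    where
    pointwise : ∀ o → Dec (o ∈ chosen σ) →
      running# (startChosen now σ o) ≡ running# (σ o) + (1# when o ∈? chosen σ)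
    pointwise o (yes o∈) = trans (cong running# (startChosen-yes now σ o∈))
      (sym (trans (cong₂ _+_ (cong running# (chosen⇒available σ o∈)) (when-yes (o ∈? chosen σ) o∈)) (+-identityˡ 1#)))
    pointwise o (no o∉) = trans (cong running# (startChosen-no now σ o∉))
      (sym (trans (+-congˡ (when-no (o ∈? chosen σ) o∉)) (+-identityʳ _)))

  running#-complete : ∀ now σ o → running# (complete now σ o) ≤ running# (σ o)
  running#-complete now σ o with σ o
  ... | unavailable   = ≤-refl
  ... | available     = ≤-refl
  ... | completedAt _ = ≤-refl
  ... | runningUntil e with e ≤? now
  ...   | yes _ = 0≤1
  ...   | no  _ = ≤-refl

  running#-reveal : ∀ σ o → running# (reveal σ o) ≡ running# (σ o)
  running#-reveal σ (τ i) = refl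
  running#-reveal σ (π i) with σ (π i) | σ (τ i)
  ... | unavailable    | unavailable    = refl
  ... | unavailable    | available      = refl
  ... | unavailable    | runningUntil _ = refl
  ... | unavailable    | completedAt _  = refl
  ... | available      | _              = refl
  ... | runningUntil _ | _              = refl
  ... | completedAt _  | _              = refl

  -- Made to hold both just before the event at `now`, when operations may be due, and just after
  -- it.
  record Consistent (now : Carrier) (σ : State) : Set (c ⊔ ℓ) where
    field
      phase   : ∀ i → Phase (σ (τ i)) (σ (π i))
      pending : ∀ {o e} → σ o ≡ runningUntil e → now ≤ e
      count≤m : count σ ≤ fromℕ m

  open Consistent

  length-ends≤m : ∀ {now σ} → Consistent now σ → length (ends (revealed now σ)) ℕ.≤ m
  length-ends≤m {now} {σ} inv = fromℕ-cancel-≤ (≤-trans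
    (≤-respˡ (count-ends (revealed now σ)) (∑-mono ops λ o →
      ≤-respˡ (sym (running#-reveal (complete now σ) o)) (running#-complete now σ o)))
    (count≤m inv))

  AllBusy : State → Set c
  AllBusy σ = ∀ {y} → σ y ≡ available → count σ ≡ fromℕ m

  -- If an operation is left waiting, the choice has filled all idle machines; at most m operations
  -- were running, so the truncated subtraction in `idle` is exact.
  event-allBusy : ∀ {now σ} → Consistent now σ → AllBusy (event now σ)
  event-allBusy {now} {σ} inv {y} eq = let (y∉ , eq′) = waits {now} {σ} eq in
    trans (count-startChosen now (revealed now σ)) (cong fromℕ
      (trans (cong (length (ends (revealed now σ)) ℕ.+_) (length-chosen (revealed now σ) eq′ y∉))
        (ℕ.m+[n∸m]≡n (length-ends≤m inv))))

  event-consistent : ∀ {now σ} → Consistent now σ → Consistent now (event now σ)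
  event-consistent {now} {σ} inv = record
    { phase   = λ i → phase-step (event-step now σ i (phase inv i))
    ; pending = λ {o} → pending-event o
    ; count≤m = ≤-respˡ (sym (count-startChosen now (revealed now σ))) (fromℕ-mono-≤
        (ℕ.≤-trans (ℕ.+-monoʳ-≤ (length (ends (revealed now σ))) (length-chosen≤ (revealed now σ)))
          (ℕ.≤-reflexive (ℕ.m+[n∸m]≡n (length-ends≤m inv)))))
    }
    where
    phase-step : ∀ {C i a b a′ b′} → Step now C i a b a′ b′ → Phase a′ b′
    phase-step (untested _)   = untested
    phase-step (test _)       = testing _
    phase-step (testing _)    = testing _
    phase-step (reveals _ _)  = tested _
    phase-step (continue _ _) = executing _ _
    phase-step (tested _)     = tested _
    phase-step (execute _)    = executing _ _
    phase-step (executing _)  = executing _ _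
    phase-step (finish _)     = done _ _
    phase-step done           = done _ _

    NotOver : Status → Set _
    NotOver s = ∀ {e} → s ≡ runningUntil e → now ≤ e

    pending-step : ∀ {C i a b a′ b′} → NotOver a → NotOver b → Step now C i a b a′ b′ → NotOver a′ × NotOver b′
    pending-step {i = i} pa pb (test _)       = (λ { refl → ≤-plus (0≤t i) }) , λ ()
    pending-step pa pb (testing _)            = pa , λ ()
    pending-step {i = i} pa pb (continue _ _) = (λ ()) , λ { refl → ≤-plus (0≤p i) }
    pending-step {i = i} pa pb (execute _)    = (λ ()) , λ { refl → ≤-plus (0≤p i) }
    pending-step pa pb (executing _)          = (λ ()) , pb
    pending-step pa pb (untested _)           = (λ ()) , λ ()
    pending-step pa pb (reveals _ _)          = (λ ()) , λ ()
    pending-step pa pb (tested _)             = (λ ()) , λ ()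
    pending-step pa pb (finish _)             = (λ ()) , λ ()
    pending-step pa pb done                   = (λ ()) , λ ()

    pending-job : ∀ i → NotOver (event now σ (τ i)) × NotOver (event now σ (π i))
    pending-job i = pending-step (pending inv) (pending inv) (event-step now σ i (phase inv i))

    pending-event : ∀ o → NotOver (event now σ o)
    pending-event (τ i) = proj₁ (pending-job i)
    pending-event (π i) = proj₂ (pending-job i)

  initial-consistent : Consistent 0# initial
  initial-consistent = record
    { phase   = λ _ → untested
    ; pending = λ { {τ _} () ; {π _} () }
    ; count≤m = ≤-respˡ (sym (trans (∑-cong ops λ { (τ _) → refl ; (π _) → refl }) (∑-zero ops))) (0≤fromℕ m)
    }

  -- A running operation with end `e` has `e - now` still to do.
  worked : Carrier → Status → Carrier → Carrier
  worked now (runningUntil e) r = r - (e - now)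
  worked now (completedAt _)  r = r
  worked now _                r = 0#

  work : Carrier → State → Carrier
  work now σ = ∑ ops λ o → worked now (σ o) (runningTime o)

  initial-work : work 0# initial ≡ 0#
  initial-work = trans (∑-cong ops λ { (τ _) → refl ; (π _) → refl }) (∑-zero ops)

  -- An operation started by the event has done nothing yet, and one completed by it ends exactly at
  -- `now`, since `pending` excludes an earlier end.
  work-event : ∀ {now σ} → Consistent now σ → work now (event now σ) ≡ work now σ
  work-event {now} {σ} inv = trans (∑-ops _) (trans
    (∑-cong jobs λ i → work-step (pending inv) (pending inv) (event-step now σ i (phase inv i)))
    (sym (∑-ops _)))
    where
    fresh : ∀ r → r - ((now + r) - now) ≡ 0#
    fresh = solve 2 (λ n r → r :- ((n :+ r) :- n) := :0) refl now
    over : ∀ {e} r → now ≤ e → e ≤ now → r ≡ r - (e - now)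
    over r now≤e e≤now with refl ← ≤-antisym now≤e e≤now = solve 2 (λ n r → r := r :- (n :- n))
        refl now r
    work-step : ∀ {C i a b a′ b′} →
      (∀ {e} → a ≡ runningUntil e → now ≤ e) → (∀ {e} → b ≡ runningUntil e → now ≤ e) →
      Step now C i a b a′ b′ →
      worked now a′ (t i) + worked now b′ (p i) ≡ worked now a (t i) + worked now b (p i)
    work-step pa pb (untested _)             = refl
    work-step {i = i} pa pb (test _)         = cong (_+ 0#) (fresh (t i))
    work-step pa pb (testing _)              = refl
    work-step {i = i} pa pb (reveals e≤ _)   = cong (_+ 0#) (over (t i) (pa refl) e≤)
    work-step {i = i} pa pb (continue e≤ _)  = cong₂ _+_ (over (t i) (pa refl) e≤) (fresh (p i))
    work-step pa pb (tested _)               = refl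
    work-step {i = i} pa pb (execute _)      = cong (t i +_) (fresh (p i))
    work-step pa pb (executing _)            = refl
    work-step {i = i} pa pb (finish e≤)      = cong (t i +_) (over (p i) (pb refl) e≤)
    work-step pa pb done                     = refl

  work-advance : ∀ now now′ σ → work now′ σ ≡ work now σ + count σ * (now′ - now)
  work-advance now now′ σ = trans (∑-cong ops pointwise)
    (trans (∑-+ ops _ _) (cong (work now σ +_) (∑-*ʳ ops (now′ - now) _)))
    where
    idles : ∀ x → x ≡ x + 0# * (now′ - now)
    idles x = solve 3 (λ x n n′ → x := x :+ :0 :* (n′ :- n)) refl x now now′
    pointwise : ∀ o → worked now′ (σ o) (runningTime o)
      ≡ worked now (σ o) (runningTime o) + running# (σ o) * (now′ - now)
    pointwise o with σ o
    ... | unavailable    = idles 0#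
    ... | available      = idles 0#
    ... | completedAt _  = idles (runningTime o)
    ... | runningUntil e = solve 4 (λ r e n n′ → r :- (e :- n′) := r :- (e :- n) :+ :1 :* (n′ :- n))
      refl (runningTime o) e now now′

  unfinished# : Status → Carrier
  unfinished# (completedAt _) = 0#
  unfinished# _               = 1#

  unfinished : State → Carrier
  unfinished σ = ∑ ops (unfinished# ∘ σ)

  0≤unfinished# : ∀ s → 0# ≤ unfinished# s
  0≤unfinished# unavailable      = 0≤1
  0≤unfinished# available        = 0≤1
  0≤unfinished# (runningUntil _) = 0≤1
  0≤unfinished# (completedAt _)  = ≤-refl

  unfinished#≤1 : ∀ s → unfinished# s ≤ 1#
  unfinished#≤1 unavailable      = ≤-refl
  unfinished#≤1 available        = ≤-refl
  unfinished#≤1 (runningUntil _) = ≤-refl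
  unfinished#≤1 (completedAt _)  = 0≤1

  unfinished-event : ∀ now σ → unfinished (event now σ) ≡ unfinished (complete now σ)
  unfinished-event now σ = ∑-cong ops λ o → trans (starting o (o ∈? chosen (revealed now σ))) (revealing o)
    where
    starting : ∀ o → Dec (o ∈ chosen (revealed now σ)) →
      unfinished# (event now σ o) ≡ unfinished# (revealed now σ o)
    starting o (yes o∈) = trans (cong unfinished# (starts⇒running {now} {σ} o∈))
      (cong unfinished# (sym (chosen⇒available (revealed now σ) o∈)))
    starting o (no o∉)  = cong unfinished# (startChosen-no now (revealed now σ) o∉)
    revealing : ∀ o → unfinished# (revealed now σ o) ≡ unfinished# (complete now σ o)
    revealing (τ i) = refl
    revealing (π i) with complete now σ (π i) | complete now σ (τ i)
    ... | unavailable    | unavailable    = refl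
    ... | unavailable    | available      = refl
    ... | unavailable    | runningUntil _ = refl
    ... | unavailable    | completedAt _  = refl
    ... | available      | _              = refl
    ... | runningUntil _ | _              = refl
    ... | completedAt _  | _              = refl

  unfinished-complete : ∀ {now σ o} → σ o ≡ runningUntil now →
    1# + unfinished (complete now σ) ≤ unfinished σ
  unfinished-complete {now} {σ} {o} eq = ≤-respˡ
    (trans (∑-+ ops _ _) (cong (_+ unfinished (complete now σ)) (∑-ops-point o 1#)))
    (∑-mono ops λ o′ → pointwise o′ (o ≟ᵒ o′))
    where
    decreases : ∀ o → unfinished# (complete now σ o) ≤ unfinished# (σ o)
    decreases o with σ o
    ... | unavailable   = ≤-refl
    ... | available     = ≤-refl
    ... | completedAt _ = ≤-refl
    ... | runningUntil e = unfinished#≤1 (if does (e ≤? now) then completedAt e else runningUntil e)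
    pointwise : ∀ o′ → Dec (o ≡ o′) → (1# when o ≟ᵒ o′) + unfinished# (complete now σ o′) ≤ unfinished# (σ o′)
    pointwise o′ (yes refl) = ≤-reflexive (trans
      (cong₂ _+_ (when-yes (o ≟ᵒ o) refl) (cong unfinished# (complete-due {now} {σ} eq ≤-refl)))
      (trans (+-identityʳ 1#) (cong unfinished# (sym eq))))
    pointwise o′ (no o≢o′) = ≤-respˡ
      (sym (trans (+-congʳ (when-no (o ≟ᵒ o′) o≢o′)) (+-identityˡ _))) (decreases o′)

  nextEvent-nothing-count : ∀ {σ} → nextEvent σ ≡ nothing → count σ ≡ 0#
  nextEvent-nothing-count {σ} eq = trans (count-ends σ) (none eq)
    where
    none : nextEvent σ ≡ nothing → fromℕ (length (ends σ)) ≡ 0#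
    none eq with ends σ
    ... | [] = refl

  Finished : State → Set c
  Finished σ = ∀ i → ∃[ e ] σ (π i) ≡ completedAt e

  -- With nothing running `count` is 0, whereas an available operation would force it to be m, which
  -- is positive.
  nextEvent-nothing-finished : ∀ {now σ} → .{{NonZero m}} → Consistent now σ → AllBusy σ →
    nextEvent σ ≡ nothing → Finished σ
  nextEvent-nothing-finished {now} {σ} inv busy none i = go (phase inv i) refl refl
    where
    nothing-available : ∀ y → σ y ≢ available
    nothing-available y eq = positive m (trans (sym (busy eq)) (nextEvent-nothing-count {σ} none))
      where
      positive : ∀ m → .{{NonZero m}} → fromℕ m ≢ 0#
      positive (suc m) = 1+≢0 (0≤fromℕ m)
    go : ∀ {a b} → Phase a b → σ (τ i) ≡ a → σ (π i) ≡ b → ∃[ e ] σ (π i) ≡ completedAt e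
    go untested         eqτ _   = contradiction eqτ (nothing-available (τ i))
    go (testing e)      eqτ _   = contradiction eqτ (nextEvent-nothing {σ} none (τ i) e)
    go (tested _)       _   eqπ = contradiction eqπ (nothing-available (π i))
    go (executing _ e′) _   eqπ = contradiction eqπ (nextEvent-nothing {σ} none (π i) e′)
    go (done _ e′)      _   eqπ = e′ , eqπ

  module _ {s} {Before After : Carrier → State → Set s} .{{_ : NonZero m}}
    (before-initial : Before 0# initial)
    (event-after : ∀ {now σ} → Consistent now σ → Before now σ → After now (event now σ))
    (advance : ∀ {now now′ σ} → Consistent now σ → AllBusy σ → now ≤ now′ → After now σ → Before now′ σ)
    where

    -- `Before` describes the state on arrival at an event time, `After` the state once the event is
    -- processed.
    run-invariant : ∃[ now ] After now final × Consistent now final × Finished final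
    run-invariant = go (suc (2 ℕ.* N)) initial-consistent before-initial (+-mono-≤ ≤-refl unfinished-initial)
      where
      unfinished-initial : unfinished (complete 0# initial) ≤ fromℕ (2 ℕ.* N)
      unfinished-initial = ≤-respʳ
        (trans (∑-const ops 1#) (trans (*-identityʳ _) (cong fromℕ length-operations)))
        (∑-mono ops λ o → unfinished#≤1 (complete 0# initial o))
        where
        length-map-allFin : ∀ (f : Fin N → Operation N) → length (map f (allFin N)) ≡ N
        length-map-allFin f = trans (length-map f (allFin N)) (length-tabulate id)
        length-operations : length ops ≡ 2 ℕ.* N
        length-operations = trans (length-++ (map τ (allFin N)))
          (cong₂ ℕ._+_ (length-map-allFin τ) (trans (length-map-allFin π) (sym (ℕ.+-identityʳ N))))

      -- The unfinished operations are counted after `complete`: the event at time 0 completes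
      -- nothing and is paid by the extra 1, and every later event by the operation that attains its
      -- time.
      go : ∀ k {now σ} → Consistent now σ → Before now σ → 1# + unfinished (complete now σ) ≤ fromℕ k →
        ∃[ now′ ] After now′ (run k now σ) × Consistent now′ (run k now σ) × Finished (run k now σ)
      go zero {now} {σ} inv before bound = contradiction
        (≤-trans bound (∑-nonNeg ops λ o → 0≤unfinished# (complete now σ o))) 1+≰
      go (suc k) {now} {σ} inv before bound with nextEvent (event now σ) in eq
      ... | nothing   = now , event-after inv before , event-consistent inv
        , nextEvent-nothing-finished (event-consistent inv) (event-allBusy inv) eq
      ... | just now′ = go k inv′ (advance (event-consistent inv) (event-allBusy inv) now≤now′ (event-after inv before))
        (≤-trans (unfinished-complete {now′} {event now σ} attained)
          (≤-respˡ (sym (unfinished-event now σ)) (difference-≤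
            (solve 2 (λ u k → k :- u := (:1 :+ k) :- (:1 :+ u))
                refl (unfinished (complete now σ)) (fromℕ k))
            bound)))
        where
        attained = proj₂ (nextEvent-attained {event now σ} eq)
        now≤now′ : now ≤ now′
        now≤now′ = pending (event-consistent inv) attained
        inv′ : Consistent now′ (event now σ)
        inv′ = record
          { phase   = phase (event-consistent inv)
          ; pending = λ {o} → nextEvent-earliest {event now σ} eq o _
          ; count≤m = count≤m (event-consistent inv)
          }

  completionTime-finished : ∀ {j e} → final (π j) ≡ completedAt e → completionTime j ≡ e
  completionTime-finished {j} eq with final (π j) | eq
  ... | _ | refl = refl

  data HasStarted : Status → Set c where
    running   : ∀ {e} → HasStarted (runningUntil e)
    completed : ∀ {e} → HasStarted (completedAt e)

  unstarted-available : ¬ HasStarted available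
  unstarted-available ()

  unstarted-unavailable : ¬ HasStarted unavailable
  unstarted-unavailable ()

  started-event : ∀ {now σ} → Consistent now σ → ∀ {o} → HasStarted (event now σ o) →
    HasStarted (σ o) ⊎ Starts now σ o
  started-event {now} {σ} inv {o} = started o
    where
    started-step : ∀ {C i a b a′ b′} → Step now C i a b a′ b′ →
      (HasStarted a′ → HasStarted a ⊎ C (τ i)) × (HasStarted b′ → HasStarted b ⊎ C (π i))
    started-step (untested _)   = (λ ()) , λ ()
    started-step (test τ∈)      = (λ _ → inj₂ τ∈) , λ ()
    started-step (testing _)    = inj₁ , λ ()
    started-step (reveals _ _)  = (λ _ → inj₁ running) , λ ()
    started-step (continue _ ∈) = (λ _ → inj₁ running) , λ _ → inj₂ ∈
    started-step (tested _)     = inj₁ , λ ()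
    started-step (execute ∈)    = inj₁ , λ _ → inj₂ ∈
    started-step (executing _)  = inj₁ , inj₁
    started-step (finish _)     = inj₁ , λ _ → inj₁ running
    started-step done           = inj₁ , inj₁
    started : ∀ o → HasStarted (event now σ o) → HasStarted (σ o) ⊎ Starts now σ o
    started (τ i) = proj₁ (started-step (event-step now σ i (phase inv i)))
    started (π i) = proj₂ (started-step (event-step now σ i (phase inv i)))

  worked-unstarted : ∀ now {s} r → ¬ HasStarted s → worked now s r ≡ 0#
  worked-unstarted now {unavailable}    r _ = refl
  worked-unstarted now {available}      r _ = refl
  worked-unstarted now {runningUntil _} r unstarted = contradiction running unstarted
  worked-unstarted now {completedAt _}  r unstarted = contradiction completed unstarted

  hasStarted? : ∀ s → Dec (HasStarted s)
  hasStarted? unavailable      = no λ ()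
  hasStarted? available        = no λ ()
  hasStarted? (runningUntil _) = yes running
  hasStarted? (completedAt _)  = yes completed

  revealed-started : ∀ {now σ o} → HasStarted (σ o) → HasStarted (revealed now σ o)
  revealed-started {now} {σ} {o} s = reveal-started o (complete-started s)
    where
    complete-started : ∀ {o} → HasStarted (σ o) → HasStarted (complete now σ o)
    complete-started {o} s with σ o
    complete-started () | unavailable
    complete-started () | available
    complete-started s  | completedAt _ = s
    complete-started s  | runningUntil e with e ≤? now
    ... | yes _ = completed
    ... | no  _ = running
    reveal-started : ∀ o → HasStarted (complete now σ o) → HasStarted (revealed now σ o)
    reveal-started (τ i) s = s
    reveal-started (π i) s with complete now σ (π i) | complete now σ (τ i)
    ... | runningUntil _ | _ = running
    ... | completedAt _  | _ = completed
    reveal-started (π i) () | unavailable | _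
    reveal-started (π i) () | available | _

  starts⇒unstarted : ∀ {now σ o} → Starts now σ o → ¬ HasStarted (σ o)
  starts⇒unstarted {now} {σ} o∈ s = unstarted-available
    (subst HasStarted (chosen⇒available (revealed now σ) o∈) (revealed-started {now} {σ} s))

  started-persists : ∀ {now σ o} → HasStarted (σ o) → HasStarted (event now σ o)
  started-persists {now} {σ} s = subst HasStarted
    (sym (startChosen-no now (revealed now σ) λ o∈ → starts⇒unstarted {now} {σ} o∈ s))
    (revealed-started {now} {σ} s)

  unstarted-test : ∀ {now σ} → Consistent now σ → ∀ i → ¬ HasStarted (σ (τ i)) → σ (τ i) ≡ available
  unstarted-test {now} {σ} inv i = go (phase inv i)
    where
    go : ∀ {a b} → Phase a b → ¬ HasStarted a → a ≡ available
    go untested        _         = refl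
    go (testing _)     unstarted = contradiction running unstarted
    go (tested _)      unstarted = contradiction completed unstarted
    go (executing _ _) unstarted = contradiction completed unstarted
    go (done _ _)      unstarted = contradiction completed unstarted

-- Upper bound for completion times on m machines.

module ParallelRun {c ℓ r} (F : OrderedField c ℓ) (tie : Scheduling.TieRule F r) (m : ℕ)
                   (I : Scheduling.Instance F) (j : Fin (Scheduling.Instance.N I)) where
  open OrderedField F
  open FieldProperties F
  open Inequalities F
  open Scheduling F
  open Instance I
  open Offline F I
  open 1-SORT tie m I
  open Run F tie m I
  open Consistent

  -- The operations that single-machine 1-SORT runs up to π j, in terms of
  -- the larger of τ j and π j.
  Small : Operation N → Set _
  Small o = o ≼ τ j ⊎ o ≼ π j

  small? : ∀ o → Dec (Small o)
  small? o = o ≼? τ j ⊎-dec o ≼? π j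

  -- On one machine a small execution behind a large test is not revealed before `π j` has run, so
  -- smallness of the test is required too.
  Relevant : Operation N → Set _
  Relevant o = Small (τ (job o)) × Small o

  relevant? : ∀ o → Dec (Relevant o)
  relevant? o = small? (τ (job o)) ×-dec small? o

  W : Carrier
  W = ∑ ops λ o → runningTime o when relevant? o

  relevant-τ : Relevant (τ j)
  relevant-τ = inj₁ (≼-refl {τ j}) , inj₁ (≼-refl {τ j})

  relevant-π : Relevant (π j)
  relevant-π = inj₁ (≼-refl {τ j}) , inj₂ (≼-refl {π j})

  AllSmall : State → Set _
  AllSmall σ = ∀ {o} → HasStarted (σ o) → Small o

  -- The situation after a large operation has been started: `π j`, still hidden, will start in the
  -- very event that reveals it.
  Blocked : State → Set _
  Blocked σ = ∀ {x} → σ x ≡ available → π j ≼ x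

  -- An execution that has started is relevant because its test started earlier and is small as
  -- well. `R` is a reserve of unstarted relevant operations, which `W` covers on top of the work
  -- already done.
  work-bound : ∀ {now σ p} {R : Operation N → Set p} (R? : ∀ o → Dec (R o)) → Consistent now σ → AllSmall σ →
    (∀ o → R o → ¬ HasStarted (σ o) × Relevant o) →
    work now σ + ∑ ops (λ o → runningTime o when R? o) ≤ W
  work-bound {now} {σ} R? inv small reserved = ≤-respˡ (∑-+ ops _ _)
    (∑-mono ops λ o → pointwise o (R? o) (hasStarted? (σ o)))
    where
    relevant : ∀ o → HasStarted (σ o) → Relevant o
    relevant (τ i) s = small s , small s
    relevant (π i) s = small (test-started (phase inv i) s) , small s
      where
      test-started : ∀ {a b} → Phase a b → HasStarted b → HasStarted a
      test-started (executing _ _) _ = completed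
      test-started (done _ _)      _ = completed
    worked≤ : ∀ o → HasStarted (σ o) → worked now (σ o) (runningTime o) ≤ runningTime o
    worked≤ o _ with σ o in eq
    ... | completedAt _  = ≤-refl
    ... | runningUntil e = ≤-minus (0≤-difference (pending inv eq))
    worked≤ o () | unavailable
    worked≤ o () | available
    pointwise : ∀ o → Dec _ → Dec (HasStarted (σ o)) →
      worked now (σ o) (runningTime o) + (runningTime o when R? o) ≤ (runningTime o when relevant? o)
    pointwise o (yes r) _ = let (unstarted , rel) = reserved o r in ≤-reflexive
      (trans (cong₂ _+_ (worked-unstarted now (runningTime o) unstarted) (when-yes (R? o) r))
        (trans (+-identityˡ _) (sym (when-yes (relevant? o) rel))))
    pointwise o (no ¬r) (yes s) = ≤-respˡ
      (sym (trans (+-congˡ (when-no (R? o) ¬r)) (+-identityʳ _)))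
      (≤-respʳ (sym (when-yes (relevant? o) (relevant o s))) (worked≤ o s))
    pointwise o (no ¬r) (no unstarted) = ≤-respˡ
      (sym (trans (cong₂ _+_ (worked-unstarted now (runningTime o) unstarted) (when-no (R? o) ¬r)) (+-identityˡ 0#)))
      (0≤when (relevant? o) (0≤runningTime o))

  work-bound-waiting : ∀ {now σ} → Consistent now σ → AllSmall σ → σ (τ j) ≡ available →
    σ (π j) ≡ unavailable → work now σ + q j ≤ W
  work-bound-waiting {now} {σ} inv small eqτ eqπ = ≤-respˡ (cong (work now σ +_) total)
    (work-bound (λ o → j Fin.≟ job o) inv small λ
      { (τ .j) refl → (λ s → unstarted-available (subst HasStarted eqτ s)) , relevant-τ
      ; (π .j) refl → (λ s → unstarted-unavailable (subst HasStarted eqπ s)) , relevant-π })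
    where
    pointwise : ∀ i → Dec (j ≡ i) → (t i when j Fin.≟ i) + (p i when j Fin.≟ i) ≡ (q j when j Fin.≟ i)
    pointwise i (yes refl) = trans (cong₂ _+_ (when-yes (j Fin.≟ j) refl) (when-yes (j Fin.≟ j) refl))
      (sym (when-yes (j Fin.≟ j) refl))
    pointwise i (no j≢i) = trans (cong₂ _+_ (when-no (j Fin.≟ i) j≢i) (when-no (j Fin.≟ i) j≢i))
      (trans (+-identityˡ 0#) (sym (when-no (j Fin.≟ i) j≢i)))
    total : ∑ ops (λ o → runningTime o when j Fin.≟ job o) ≡ q j
    total = trans (∑-ops _) (trans (∑-cong jobs λ i → pointwise i (j Fin.≟ i)) (∑-jobs-point j (q j)))

  -- At time 0 no work is done and the whole job `j` is in reserve.
  q≤W : q j ≤ W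
  q≤W = ≤-respˡ (trans (cong (_+ q j) initial-work) (+-identityˡ (q j)))
    (work-bound-waiting initial-consistent (λ { {τ _} () ; {π _} () }) refl refl)

  work-bound-tested : ∀ {now σ} → Consistent now σ → AllSmall σ → σ (π j) ≡ available →
    work now σ + p j ≤ W
  work-bound-tested {now} {σ} inv small eqπ = ≤-respˡ (cong (work now σ +_) total)
    (work-bound (λ o → π j ≟ᵒ o) inv small λ { _ refl →
        (λ s → unstarted-available (subst HasStarted eqπ s)) , relevant-π })
    where
    pointwise : ∀ o → Dec (π j ≡ o) → (runningTime o when π j ≟ᵒ o) ≡ (p j when π j ≟ᵒ o)
    pointwise o (yes refl) = refl
    pointwise o (no πj≢o)  = trans (when-no (π j ≟ᵒ o) πj≢o) (sym (when-no (π j ≟ᵒ o) πj≢o))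
    total : ∑ ops (λ o → runningTime o when π j ≟ᵒ o) ≡ p j
    total = trans (∑-cong ops λ o → pointwise o (π j ≟ᵒ o)) (∑-ops-point (π j) (p j))

  -- The test starts at `e - t j`. Until then all machines work; during the test only the machine of
  -- `τ j` is counted; while `π j` waits, all of them work again. This gives `m * (now - t j) + t j`
  -- in `tested`. In `executing`, `e′` is already the completion time of `j`.
  data Progress (now : Carrier) (σ : State) : (σ-τj σ-πj : Status) → Set (c ⊔ ℓ ⊔ r) where
    waiting   : AllSmall σ → fromℕ m * now ≤ work now σ → Progress now σ available unavailable
    testing   : ∀ {e} → fromℕ m * (e - t j) ≤ W - q j →
                Blocked σ ⊎ (AllSmall σ × fromℕ m * (e - t j) + (now - (e - t j)) ≤ work now σ) →
                Progress now σ (runningUntil e) unavailable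
    tested    : ∀ {e} → AllSmall σ → fromℕ m * (now - t j) + t j ≤ work now σ →
                Progress now σ (completedAt e) available
    executing : ∀ {e e′} → fromℕ m * (e′ - q j) ≤ W - q j → Progress now σ (completedAt e) (runningUntil e′)
    done      : ∀ {e e′} → fromℕ m * (e′ - q j) ≤ W - q j → Progress now σ (completedAt e) (completedAt e′)

  module _ {now σ} (inv : Consistent now σ) where

    private
      σ′ : State
      σ′ = event now σ

    -- Each completed test frees a machine for the one operation that it reveals,
    -- so a revealed operation waits only behind one that was available before.
    revealed-never-wait : ∀ {y} → (∀ {x} → Starts now σ x → σ x ≢ available) → σ y ≢ available →
      σ′ y ≢ available
    -- If `y` waited, all m machines would be busy afterwards. But every started operation was
    -- revealed just now and merely replaces its own test, while the machine that revealed `y` is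
    -- freed without replacement: the count drops below m.
    revealed-never-wait {y} fresh y-fresh y-waits = 1+≰ (≤-respˡ
      (trans (cong (_+ count σ′) (∑-jobs-point (job y) 1#))
        (cong (1# +_) (event-allBusy inv y-waits)))
      (≤-trans (≤-respʳ (sym (∑-ops _)) (≤-respˡ
        (trans (∑-+ jobs _ _) (cong (∑ jobs (λ i → 1# when job y Fin.≟ i) +_) (sym (∑-ops _))))
        (∑-mono jobs λ i → pointwise i (job y Fin.≟ i))))
        (count≤m inv)))
      where
      not-available-before : ∀ i → σ (τ i) ≡ available ⊎ σ′ (τ i) ≢ available →
        σ (π i) ≡ available ⊎ σ′ (π i) ≢ available → job y ≢ i
      not-available-before i τ-case π-case refl = at y y-waits y-fresh τ-case π-case
        where
        at : ∀ y → σ′ y ≡ available → σ y ≢ available →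
          σ (τ (job y)) ≡ available ⊎ σ′ (τ (job y)) ≢ available →
          σ (π (job y)) ≡ available ⊎ σ′ (π (job y)) ≢ available → ⊥
        at (τ i) eq fresh (inj₁ old) _ = fresh old
        at (τ i) eq fresh (inj₂ new) _ = new eq
        at (π i) eq fresh _ (inj₁ old) = fresh old
        at (π i) eq fresh _ (inj₂ new) = new eq

      pointwise : ∀ i → Dec (job y ≡ i) →
        (1# when job y Fin.≟ i) + (running# (σ′ (τ i)) + running# (σ′ (π i))) ≤ running# (σ (τ i)) + running# (σ (π i))
      pointwise i here? = go (event-step now σ i (phase inv i)) refl refl refl refl
        where
        elsewhere : ∀ {u v} → u ≤ v → job y ≢ i → (1# when job y Fin.≟ i) + u ≤ v
        elsewhere u≤v y≢i = ≤-respˡ (sym (trans (+-congʳ (when-no (job y Fin.≟ i) y≢i)) (+-identityˡ _))) u≤v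

        frees : (1# when job y Fin.≟ i) + (0# + 0#) ≤ 1#
        frees = ≤-respˡ (sym (solve 1 (λ u → u :+ (:0 :+ :0) := u)
            refl _)) (when≤ (job y Fin.≟ i) 0≤1)

        go : ∀ {a b a′ b′} → Step now (Starts now σ) i a b a′ b′ →
          σ (τ i) ≡ a → σ (π i) ≡ b → σ′ (τ i) ≡ a′ → σ′ (π i) ≡ b′ →
          (1# when job y Fin.≟ i) + (running# a′ + running# b′) ≤ running# a + running# b
        go (untested _) τ≡ π≡ τ′≡ π′≡ = elsewhere ≤-refl
          (not-available-before i (inj₁ τ≡) (inj₂ λ eq → case trans (sym π′≡) eq of λ ()))
        go (test τ∈) τ≡ _ _ _ = contradiction τ≡ (fresh τ∈)
        go (testing _) τ≡ π≡ τ′≡ π′≡ = elsewhere ≤-refl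
          (not-available-before i (inj₂ λ eq → case trans (sym τ′≡) eq of λ ())
              (inj₂ λ eq → case trans (sym π′≡) eq of λ ()))
        go (reveals _ _) _ _ _ _ = ≤-respʳ (sym (+-identityʳ 1#)) frees
        go (continue _ _) τ≡ π≡ τ′≡ π′≡ = elsewhere (≤-reflexive (+-comm 0# 1#))
          (not-available-before i (inj₂ λ eq → case trans (sym τ′≡) eq of λ ())
              (inj₂ λ eq → case trans (sym π′≡) eq of λ ()))
        go (tested _) τ≡ π≡ τ′≡ π′≡ = elsewhere ≤-refl
          (not-available-before i (inj₂ λ eq → case trans (sym τ′≡) eq of λ ()) (inj₁ π≡))
        go (execute π∈) _ π≡ _ _ = contradiction π≡ (fresh π∈)
        go (executing _) τ≡ π≡ τ′≡ π′≡ = elsewhere ≤-refl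
          (not-available-before i (inj₂ λ eq → case trans (sym τ′≡) eq of λ ())
              (inj₂ λ eq → case trans (sym π′≡) eq of λ ()))
        go (finish _) _ _ _ _ = ≤-respʳ (sym (+-identityˡ 1#)) frees
        go done τ≡ π≡ τ′≡ π′≡ = elsewhere ≤-refl
          (not-available-before i (inj₂ λ eq → case trans (sym τ′≡) eq of λ ())
              (inj₂ λ eq → case trans (sym π′≡) eq of λ ()))

    -- If such a `y` waited, everything started would be at most `y`, hence at most `π j`. Blocking
    -- leaves only `π j` itself as a candidate that was available before, and it was hidden; so
    -- `revealed-never-wait` applies.
    blocked-event : σ (π j) ≡ unavailable → Blocked σ → ∀ {y} → y ≼ π j → σ′ y ≢ available
    blocked-event hidden blocked {y} y≼πj y-waits =
      revealed-never-wait (λ {x} x∈ → fresh (≼-trans {x} (starts-minimal {now} {σ} x∈ y-waits) y≼πj)) (fresh y≼πj) y-waits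
      where
      fresh : ∀ {x} → x ≼ π j → σ x ≢ available
      fresh x≼πj eq with refl ← ≼-antisym x≼πj (blocked eq) with () ← trans (sym hidden) eq

    blocked-stays : σ (π j) ≡ unavailable → Blocked σ → Blocked σ′
    blocked-stays hidden blocked {y} eq with ≼-total (π j) y
    ... | inj₁ πj≼y = πj≼y
    ... | inj₂ y≼πj = contradiction eq (blocked-event hidden blocked y≼πj)

    allSmall-event : AllSmall σ → (∀ {o} → Starts now σ o → Small o) → AllSmall σ′
    allSmall-event small starts-small s with started-event inv s
    ... | inj₁ s   = small s
    ... | inj₂ o∈ = starts-small o∈

    -- A started operation that is not small lies above `π j`, and everything still waiting lies
    -- above that operation.
    blocked-or-small : AllSmall σ → Blocked σ′ ⊎ AllSmall σ′
    blocked-or-small small with any? (¬? ∘ small?) (chosen (revealed now σ))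
    ... | no none = inj₂ (allSmall-event small starts-small)
      where
      starts-small : ∀ {o} → Starts now σ o → Small o
      starts-small {o} o∈ with small? o
      ... | yes s = s
      ... | no ¬s = contradiction (lose o∈ ¬s) none
    ... | yes any with (x , x∈ , ¬small) ← find any = inj₁ λ {y} eq →
      ≼-trans {π j} (πj≼x x ¬small) (starts-minimal {now} {σ} x∈ eq)
      where
      πj≼x : ∀ x → ¬ Small x → π j ≼ x
      πj≼x x ¬small with ≼-total (π j) x
      ... | inj₁ πj≼x = πj≼x
      ... | inj₂ x≼πj = contradiction (inj₂ x≼πj) ¬small

    progress-event : Progress now σ (σ (τ j)) (σ (π j)) → Progress now σ′ (σ′ (τ j)) (σ′ (π j))
    progress-event = go (event-step now σ j (phase inv j)) refl refl refl refl
      where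
      M : Carrier
      M = fromℕ m

      same-work : ∀ {z} → z ≤ work now σ → z ≤ work now σ′
      same-work = ≤-respʳ (sym (work-event inv))

      execution-bound : ∀ {e} → M * (e - t j) ≤ W - q j → M * (e + p j - q j) ≤ W - q j
      execution-bound {e} = ≤-respˡ (solve 4 (λ m e t p → m :* (e :- t) := m :* (e :+ p :- (t :+ p)))
          refl M e (t j) (p j))

      due-now : ∀ {e} → σ (τ j) ≡ runningUntil e → e ≤ now → e ≡ now
      due-now eq e≤now = ≤-antisym e≤now (pending inv eq)

      go : ∀ {a b a′ b′} → Step now (Starts now σ) j a b a′ b′ →
        σ (τ j) ≡ a → σ (π j) ≡ b → σ′ (τ j) ≡ a′ → σ′ (π j) ≡ b′ →
        Progress now σ a b → Progress now σ′ a′ b′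
      go (untested _) τ≡ π≡ τ′≡ π′≡ (waiting small w) = waiting
        -- `τ j` is passed over, so whatever starts is at most `τ j`.
        (allSmall-event small λ x∈ → inj₁ (starts-minimal {now} {σ} x∈ τ′≡)) (same-work w)
      go (test _) τ≡ π≡ τ′≡ π′≡ (waiting small w) = testing
        (difference-≤ (solve 5 (λ m n t w q → (w :- q) :- m :* (n :+ t :- t) := w :- (m :* n :+ q))
            refl M now (t j) W (q j))
          (≤-trans (+-monoˡ-≤ (q j) w) (work-bound-waiting inv small τ≡ π≡)))
        ([ inj₁ , (λ small′ → inj₂ (small′ , same-work (≤-respˡ
          (solve 3 (λ m n t → m :* n := m :* (n :+ t :- t) :+ (n :- (n :+ t :- t)))
              refl M now (t j)) w))) ]′
          (blocked-or-small small))
      go (testing _) τ≡ π≡ τ′≡ π′≡ (testing bound (inj₁ blocked)) =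
        testing bound (inj₁ (blocked-stays π≡ blocked))
      go (testing _) τ≡ π≡ τ′≡ π′≡ (testing bound (inj₂ (small , w))) = testing bound
        ([ inj₁ , (λ small′ → inj₂ (small′ , same-work w)) ]′ (blocked-or-small small))
      -- This case cannot occur: a blocked state starts `π j` as soon as it is revealed.
      go (reveals _ _) τ≡ π≡ τ′≡ π′≡ (testing bound (inj₁ blocked)) =
        contradiction π′≡ (blocked-event π≡ blocked (≼-refl {π j}))
      go (reveals e≤now _) τ≡ π≡ τ′≡ π′≡ (testing {e} bound (inj₂ (small , w))) with refl ← due-now τ≡ e≤now =
          tested
        (allSmall-event small λ x∈ → inj₂ (starts-minimal {now} {σ} x∈ π′≡))
        (same-work (≤-respˡ (solve 3 (λ m n t → m :* (n :- t) :+ (n :- (n :- t)) := m :* (n :- t) :+ t)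
            refl M now (t j)) w))
      -- Without delay `π j` ends at `e + p j`, and `e + p j - q j` is the start of the test, where
      -- the bound is known.
      go (continue e≤now _) τ≡ π≡ τ′≡ π′≡ (testing bound _) with refl ← due-now τ≡ e≤now =
        executing (execution-bound bound)
      go (tested _) τ≡ π≡ τ′≡ π′≡ (tested small w) = tested
        (allSmall-event small λ x∈ → inj₂ (starts-minimal {now} {σ} x∈ π′≡)) (same-work w)
      go (execute _) τ≡ π≡ τ′≡ π′≡ (tested small w) = executing (execution-bound
        (difference-≤ (solve 5 (λ m n t w p → (w :- (t :+ p)) :- m :* (n :- t) := w :- (m :* (n :- t) :+ t :+ p))
            refl M now (t j) W (p j))
          (≤-trans (+-monoˡ-≤ (p j) w) (work-bound-tested inv small π≡))))
      go (executing _) τ≡ π≡ τ′≡ π′≡ (executing bound) = executing bound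
      go (finish _) τ≡ π≡ τ′≡ π′≡ (executing bound) = done bound
      go done τ≡ π≡ τ′≡ π′≡ (done bound) = done bound

  progress-advance : ∀ {now now′ σ} → Consistent now σ → AllBusy σ → now ≤ now′ →
    Progress now σ (σ (τ j)) (σ (π j)) → Progress now′ σ (σ (τ j)) (σ (π j))
  progress-advance {now} {now′} {σ} inv busy now≤now′ = go refl refl
    where
    M : Carrier
    M = fromℕ m

    works : ∀ {x y} → y - x ≤ count σ * (now′ - now) → x ≤ work now σ → y ≤ work now′ σ
    works {x} {y} le w = ≤-respʳ (sym (work-advance now now′ σ))
      (≤-respˡ (solve 2 (λ x y → x :+ (y :- x) := y) refl x y) (+-mono-≤ w le))

    busy-works : ∀ {o} x → σ o ≡ available → M * (now′ - x) - M * (now - x) ≤ count σ * (now′ - now)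
    busy-works x eq = ≤-reflexive (trans
      (solve 4 (λ m n n′ x → m :* (n′ :- x) :- m :* (n :- x) := m :* (n′ :- n)) refl M now now′ x)
      (cong (_* (now′ - now)) (sym (busy eq))))

    running-counts : ∀ {o e} → σ o ≡ runningUntil e → 1# ≤ count σ
    running-counts {o} eq = ≤-respˡ (∑-ops-point o 1#) (∑-mono ops λ o′ → pointwise o′ (o ≟ᵒ o′))
      where
      pointwise : ∀ o′ → Dec (o ≡ o′) → (1# when o ≟ᵒ o′) ≤ running# (σ o′)
      pointwise o′ (yes refl) = ≤-reflexive (trans (when-yes (o ≟ᵒ o) refl) (cong running# (sym eq)))
      pointwise o′ (no o≢o′)  = ≤-respˡ (sym (when-no (o ≟ᵒ o′) o≢o′)) (0≤running# (σ o′))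

    go : ∀ {a b} → σ (τ j) ≡ a → σ (π j) ≡ b → Progress now σ a b → Progress now′ σ a b
    go τ≡ π≡ (waiting small w) = waiting small (works (≤-respˡ
      (solve 3 (λ m n n′ → m :* (n′ :- :0) :- m :* (n :- :0) := m :* n′ :- m :* n) refl M now now′)
      (busy-works 0# τ≡)) w)
    go τ≡ π≡ (testing bound (inj₁ blocked)) = testing bound (inj₁ blocked)
    -- The rate 1 comes from `τ j` itself; nothing need be waiting, so the other machines may idle.
    go τ≡ π≡ (testing {e} bound (inj₂ (small , w))) = testing bound (inj₂ (small , works
      (≤-respˡ (solve 4 (λ b s n n′ → (n′ :- n) :* :1 := (b :+ (n′ :- s)) :- (b :+ (n :- s)))
          refl (M * (e - t j)) (e - t j) now now′)
        (≤-respʳ (*-comm _ _) (*-monoˡ-≤ (0≤-difference now≤now′) (running-counts τ≡)))) w))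
    go τ≡ π≡ (tested small w) = tested small (works (≤-respˡ
      (solve 4 (λ m n n′ t → m :* (n′ :- t) :- m :* (n :- t) := (m :* (n′ :- t) :+ t) :- (m :* (n :- t) :+ t))
          refl M now now′ (t j))
      (busy-works (t j) π≡)) w)
    go τ≡ π≡ (executing bound) = executing bound
    go τ≡ π≡ (done bound) = done bound

  parallel-completion : .{{NonZero m}} → fromℕ m * (completionTime j - q j) ≤ W - q j
  parallel-completion = bound (run-invariant {Before = λ now σ → Progress now σ (σ (τ j)) (σ (π j))}
    (waiting (λ { {τ _} () ; {π _} () }) (≤-reflexive
      (trans (zeroʳ _) (sym initial-work))))
    progress-event progress-advance)
    where
    finished-bound : ∀ {now σ a b e} → Progress now σ a b → b ≡ completedAt e → fromℕ m * (e - q j) ≤ W - q j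
    finished-bound (done bound) refl = bound
    bound : (∃[ now ] Progress now final (final (τ j)) (final (π j)) × Consistent now final × Finished final) →
      fromℕ m * (completionTime j - q j) ≤ W - q j
    bound (_ , progress , _ , finished) = let (e , eq) = finished j in
      subst (λ C → fromℕ m * (C - q j) ≤ W - q j) (sym (completionTime-finished eq)) (finished-bound progress eq)

-- Lower bound for completion times on one machine.

module SequentialRun {c ℓ r} (F : OrderedField c ℓ) (tie : Scheduling.TieRule F r)
                     (I : Scheduling.Instance F) (j : Fin (Scheduling.Instance.N I)) where
  open OrderedField F
  open FieldProperties F
  open Inequalities F
  open Scheduling F
  open Instance I
  open Offline F I
  open 1-SORT tie 1 I
  open Run F tie 1 I
  open Consistent
  open ParallelRun F tie 1 I j

  single-running : ∀ {now σ} → Consistent now σ → ∀ {x y e e′} → σ x ≡ runningUntil e → σ y ≡ runningUntil e′ → x ≡ y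
  single-running {now} {σ} inv {x} {y} x-runs y-runs with x ≟ᵒ y
  ... | yes x≡y = x≡y
  ... | no  x≢y = contradiction (≤-trans (≤-respˡ
      (trans (∑-+ ops _ _) (cong₂ _+_ (∑-ops-point x 1#) (∑-ops-point y 1#)))
      (∑-mono ops λ o → pointwise o (x ≟ᵒ o) (y ≟ᵒ o))) (≤-respʳ (+-identityʳ 1#) (count≤m inv))) 1+≰
    where
    pointwise : ∀ o → Dec (x ≡ o) → Dec (y ≡ o) → (1# when x ≟ᵒ o) + (1# when y ≟ᵒ o) ≤ running# (σ o)
    pointwise o (yes refl) (yes refl) = contradiction refl x≢y
    pointwise o (yes refl) (no y≢o)   = ≤-reflexive (trans
      (cong₂ _+_ (when-yes (x ≟ᵒ o) refl) (when-no (y ≟ᵒ o) y≢o)) (trans (+-identityʳ 1#) (cong running# (sym x-runs))))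
    pointwise o (no x≢o)   (yes refl) = ≤-reflexive (trans
      (cong₂ _+_ (when-no (x ≟ᵒ o) x≢o) (when-yes (y ≟ᵒ o) refl)) (trans (+-identityˡ 1#) (cong running# (sym y-runs))))
    pointwise o (no x≢o)   (no y≢o)   = ≤-respˡ
      (sym (trans (cong₂ _+_ (when-no (x ≟ᵒ o) x≢o) (when-no (y ≟ᵒ o) y≢o)) (+-identityˡ 0#))) (0≤running# (σ o))

  -- The end is fixed at the start, so `W≤end` can be proved when `π j` starts and then merely
  -- persists.
  Ends : Status → Carrier → Set c
  Ends s e = s ≡ runningUntil e ⊎ s ≡ completedAt e

  record Sequential (now : Carrier) (σ : State) : Set (c ⊔ ℓ ⊔ r) where
    field
      work≤now       : work now σ ≤ now
      tests-in-order : ∀ {i k} → HasStarted (σ (τ i)) → σ (τ k) ≡ available → τ i ≼ τ k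
      -- Of two jobs that both await their execution, the one tested later was preferred to
      -- the execution of the other.
      awaiting       : ∀ {i k} → i ≢ k → HasStarted (σ (τ i)) → HasStarted (σ (τ k)) →
                       ¬ HasStarted (σ (π i)) → ¬ HasStarted (σ (π k)) →
                       (τ i ≼ τ k × τ k ≼ π i) ⊎ (τ k ≼ τ i × τ i ≼ π k)
      W≤end          : ∀ {e} → Ends (σ (π j)) e → W ≤ e

  open Sequential

  sequential-initial : Sequential 0# initial
  sequential-initial = record
    { work≤now       = ≤-reflexive initial-work
    ; tests-in-order = λ ()
    ; awaiting       = λ _ ()
    ; W≤end          = λ { (inj₁ ()) ; (inj₂ ()) }
    }

  module _ {now σ} (inv : Consistent now σ) (seq : Sequential now σ) where

    private
      σ′ : State
      σ′ = event now σ

      inv′ : Consistent now σ′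
      inv′ = event-consistent inv

      starts-running : ∀ {o} → Starts now σ o → σ′ o ≡ runningUntil (now + runningTime o)
      starts-running = starts⇒running {now} {σ}

      tests-in-order′ : ∀ {i k} → HasStarted (σ′ (τ i)) → σ′ (τ k) ≡ available → τ i ≼ τ k
      tests-in-order′ {i} {k} s eq with started-event inv s
      ... | inj₂ τ∈  = starts-minimal {now} {σ} τ∈ eq
      ... | inj₁ old = tests-in-order seq old (unstarted-test inv k
        λ s → unstarted-available (subst HasStarted eq (started-persists {now} {σ} s)))

      completed-started : ∀ {o e} → σ′ o ≡ completedAt e → HasStarted (σ o)
      completed-started eq with started-event inv (subst HasStarted (sym eq) completed)
      ... | inj₁ s  = s
      ... | inj₂ o∈ = case trans (sym eq) (starts-running o∈) of λ ()

      -- Only one operation runs, so when `τ k` starts, `τ i` is complete and `π i` is available; it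
      -- was passed over in favour of `τ k`.
      later-test : ∀ {i k} → i ≢ k → HasStarted (σ (τ i)) → Starts now σ (τ k) → ¬ HasStarted (σ′ (π i)) →
        τ i ≼ τ k × τ k ≼ π i
      later-test {i} {k} i≢k s τk∈ πi-unstarted =
        tests-in-order seq s (unstarted-test inv k (starts⇒unstarted {now} {σ} τk∈)) ,
        starts-minimal {now} {σ} τk∈ (awaits (phase inv′ i) refl refl)
        where
        awaits : ∀ {a b} → Phase a b → σ′ (τ i) ≡ a → σ′ (π i) ≡ b → σ′ (π i) ≡ available
        awaits untested        τ≡ _  = contradiction (subst HasStarted τ≡ (started-persists {now} {σ} s)) unstarted-available
        awaits (testing _)     τ≡ _  with refl ← single-running inv′ τ≡ (starts-running τk∈) =
            contradiction refl i≢k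
        awaits (tested _)      _  π≡ = π≡
        awaits (executing _ _) _  π≡ = contradiction (subst HasStarted (sym π≡) running) πi-unstarted
        awaits (done _ _)      _  π≡ = contradiction (subst HasStarted (sym π≡) completed) πi-unstarted

      awaiting′ : ∀ {i k} → i ≢ k → HasStarted (σ′ (τ i)) → HasStarted (σ′ (τ k)) →
        ¬ HasStarted (σ′ (π i)) → ¬ HasStarted (σ′ (π k)) →
        (τ i ≼ τ k × τ k ≼ π i) ⊎ (τ k ≼ τ i × τ i ≼ π k)
      awaiting′ i≢k si sk ui uk with started-event inv si | started-event inv sk
      ... | inj₁ si | inj₁ sk = awaiting seq i≢k si sk (ui ∘ started-persists {now} {σ}) (uk ∘ started-persists {now} {σ})
      ... | inj₁ si | inj₂ k∈ = inj₁ (later-test i≢k si k∈ ui)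
      ... | inj₂ i∈ | inj₁ sk = inj₂ (later-test (i≢k ∘ sym) sk i∈ uk)
      ... | inj₂ i∈ | inj₂ k∈ with refl ← single-running inv′ (starts-running i∈) (starts-running k∈) =
          contradiction refl i≢k

      module _ (πj∈ : Starts now σ (π j)) where

        τj-completed : ∃[ e ] σ′ (τ j) ≡ completedAt e
        τj-completed = go (phase inv′ j) refl refl
          where
          go : ∀ {a b} → Phase a b → σ′ (τ j) ≡ a → σ′ (π j) ≡ b → ∃[ e ] σ′ (τ j) ≡ completedAt e
          go untested        _  π≡ = case trans (sym π≡) (starts-running πj∈) of λ ()
          go (testing _)     _  π≡ = case trans (sym π≡) (starts-running πj∈) of λ ()
          go (tested e)      τ≡ _  = e , τ≡
          go (executing e _) τ≡ _  = e , τ≡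
          go (done e _)      τ≡ _  = e , τ≡

        -- A waiting test that is at most `π j` would have been chosen instead of `π j`; one that is
        -- at most `τ j` cannot still wait after `τ j` by the order of the tests.
        small-test-completed : ∀ i → Small (τ i) → ∃[ e ] σ′ (τ i) ≡ completedAt e
        small-test-completed i small = go (phase inv′ i) refl
          where
          unavailing : σ′ (τ i) ≡ available → Small (τ i) → ⊥
          unavailing τ≡ (inj₂ τi≼πj) with () ← ≼-antisym {τ i} {π j} τi≼πj (starts-minimal {now} {σ} πj∈ τ≡)
          unavailing τ≡ (inj₁ τi≼τj) with (_ , τj≡) ← τj-completed
            with refl ← ≼-antisym {τ i} {τ j} τi≼τj (tests-in-order′ (subst HasStarted (sym τj≡) completed) τ≡) =
            case trans (sym τ≡) τj≡ of λ ()
          go : ∀ {a b} → Phase a b → σ′ (τ i) ≡ a → ∃[ e ] σ′ (τ i) ≡ completedAt e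
          go untested        τ≡ = contradiction small (unavailing τ≡)
          go (testing _)     τ≡ with () ← single-running inv′ τ≡ (starts-running πj∈)
          go (tested e)      τ≡ = e , τ≡
          go (executing e _) τ≡ = e , τ≡
          go (done e _)      τ≡ = e , τ≡

        relevant-completed : ∀ o → π j ≢ o → Relevant o → ∃[ e ] σ′ o ≡ completedAt e
        relevant-completed (τ i) _     (_ , small)      = small-test-completed i small
        relevant-completed (π i) πj≢πi (τ-small , small) = go (phase inv′ i) refl refl
          where
          τi≡ = proj₂ (small-test-completed i τ-small)
          unavailing : σ′ (π i) ≡ available → Small (π i) → ⊥
          unavailing π≡ (inj₂ πi≼πj) = πj≢πi (≼-antisym {π j} {π i} (starts-minimal {now} {σ} πj∈ π≡) πi≼πj)
          -- Here `π j ≼ π i ≼ τ j`. Whichever of `τ i` and `τ j` ran later, the preferences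
          -- recorded in `awaiting` close a cycle that would identify an execution with a test.
          unavailing π≡ (inj₁ πi≼τj)
            with awaiting seq {j} {i} (λ j≡i → πj≢πi (cong π j≡i))
              (completed-started (proj₂ τj-completed)) (completed-started τi≡)
              (starts⇒unstarted {now} {σ} πj∈)
              (λ s → unstarted-available (subst HasStarted π≡ (started-persists {now} {σ} s)))
          ... | inj₁ (τj≼τi , τi≼πj) with () ← ≼-antisym {π j} {τ j}
                (≼-trans {π j} (starts-minimal {now} {σ} πj∈ π≡) πi≼τj) (≼-trans {τ j} τj≼τi τi≼πj)
          ... | inj₂ (_ , τj≼πi) with () ← ≼-antisym {π i} {τ j} πi≼τj τj≼πi
          go : ∀ {a b} → Phase a b → σ′ (τ i) ≡ a → σ′ (π i) ≡ b → ∃[ e ] σ′ (π i) ≡ completedAt e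
          go untested        τ≡ _  = case trans (sym τ≡) τi≡ of λ ()
          go (testing _)     τ≡ _  = case trans (sym τ≡) τi≡ of λ ()
          go (tested _)      _  π≡ = contradiction small (unavailing π≡)
          go (executing _ _) _  π≡ = contradiction (single-running inv′ (starts-running πj∈) π≡) πj≢πi
          go (done _ e)      _  π≡ = e , π≡

        -- All other relevant operations are complete, whereas `π j` has just started and has done
        -- no work, which `p j` makes up for.
        W≤work : W ≤ work now σ′ + p j
        W≤work = ≤-respʳ (trans (∑-+ ops _ _) (cong (work now σ′ +_) (∑-ops-point (π j) (p j))))
          (∑-mono ops λ o → pointwise o (π j ≟ᵒ o) (relevant? o))
          where
          nonNeg : ∀ o → π j ≢ o → 0# ≤ worked now (σ′ o) (runningTime o)
          nonNeg o πj≢o = go (σ′ o) refl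
            where
            go : ∀ s → σ′ o ≡ s → 0# ≤ worked now s (runningTime o)
            go unavailable      _  = ≤-refl
            go available        _  = ≤-refl
            go (completedAt _)  _  = 0≤runningTime o
            go (runningUntil _) eq = contradiction (single-running inv′ (starts-running πj∈) eq) πj≢o
          pointwise : ∀ o → Dec (π j ≡ o) → Dec (Relevant o) →
            (runningTime o when relevant? o) ≤ worked now (σ′ o) (runningTime o) + (p j when π j ≟ᵒ o)
          pointwise o (yes refl) _ = ≤-trans (when≤ (relevant? o) (0≤p j)) (≤-reflexive (sym (trans
            (cong₂ _+_ (cong (λ s → worked now s (p j)) (starts-running πj∈)) (when-yes (π j ≟ᵒ π j) refl))
            (solve 2 (λ n p → (p :- ((n :+ p) :- n)) :+ p := p) refl now (p j)))))
          pointwise o (no πj≢o) (yes rel) = ≤-reflexive (trans (when-yes (relevant? o) rel) (sym (trans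
            (cong₂ _+_ (cong (λ s → worked now s (runningTime o)) (proj₂ (relevant-completed o πj≢o rel)))
              (when-no (π j ≟ᵒ o) πj≢o)) (+-identityʳ _))))
          pointwise o (no πj≢o) (no ¬rel) = ≤-respˡ (sym (when-no (relevant? o) ¬rel))
            (≤-respʳ (sym (trans (+-congˡ (when-no (π j ≟ᵒ o) πj≢o)) (+-identityʳ _))) (nonNeg o πj≢o))

        W≤start : W ≤ now + p j
        W≤start = ≤-trans W≤work (+-monoˡ-≤ (p j) (≤-respˡ (sym (work-event inv)) (work≤now seq)))

      W≤end′ : ∀ {e} → Ends (σ′ (π j)) e → W ≤ e
      W≤end′ {e} = go (event-step now σ j (phase inv j)) refl
        where
        go : ∀ {a b a′ b′} → Step now (Starts now σ) j a b a′ b′ → σ (π j) ≡ b → Ends b′ e → W ≤ e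
        go (continue _ πj∈) _  (inj₁ refl) = W≤start πj∈
        go (execute πj∈)    _  (inj₁ refl) = W≤start πj∈
        go (executing _)    π≡ (inj₁ refl) = W≤end seq (inj₁ π≡)
        go (finish _)       π≡ (inj₂ refl) = W≤end seq (inj₁ π≡)
        go done             π≡ (inj₂ refl) = W≤end seq (inj₂ π≡)
        go (untested _)  _ (inj₁ ())
        go (untested _)  _ (inj₂ ())
        go (test _)      _ (inj₁ ())
        go (test _)      _ (inj₂ ())
        go (testing _)   _ (inj₁ ())
        go (testing _)   _ (inj₂ ())
        go (reveals _ _) _ (inj₁ ())
        go (reveals _ _) _ (inj₂ ())
        go (tested _)    _ (inj₁ ())
        go (tested _)    _ (inj₂ ())

    sequential-event : Sequential now σ′
    sequential-event = record
      { work≤now       = ≤-respˡ (sym (work-event inv)) (work≤now seq)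
      ; tests-in-order = tests-in-order′
      ; awaiting       = awaiting′
      ; W≤end          = W≤end′
      }

  sequential-advance : ∀ {now now′ σ} → Consistent now σ → AllBusy σ → now ≤ now′ →
    Sequential now σ → Sequential now′ σ
  sequential-advance {now} {now′} {σ} inv _ now≤now′ seq = record
    { work≤now       = ≤-respˡ (sym (work-advance now now′ σ)) (≤-trans
        (+-mono-≤ (work≤now seq) (≤-respˡ (*-comm _ _)
          (*-monoˡ-≤ (0≤-difference now≤now′) (count≤m inv))))
        (≤-reflexive (solve 2 (λ n n′ → n :+ (n′ :- n) :* (:1 :+ :0) := n′) refl now now′)))
    ; tests-in-order = tests-in-order seq
    ; awaiting       = awaiting seq
    ; W≤end          = W≤end seq
    }

  sequential-completion : W ≤ completionTime j
  sequential-completion = bound (run-invariant {Before = Sequential} {After = Sequential}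
    sequential-initial sequential-event sequential-advance)
    where
    bound : (∃[ now ] Sequential now final × Consistent now final × Finished final) → W ≤ completionTime j
    bound (_ , seq , _ , finished) = let (e , eq) = finished j in
      ≤-respʳ (sym (completionTime-finished eq)) (W≤end seq (inj₂ eq))

-- Comparison of the two runs and the final arithmetic.

module Comparison {c ℓ r} (F : OrderedField c ℓ) (tie : Scheduling.TieRule F r) where
  open OrderedField F
  open FieldProperties F
  open Inequalities F
  open Scheduling F

  module _ (I : Instance) where
    open Instance I
    open Offline F I

    ∑W : Carrier
    ∑W = ∑ jobs λ j → ParallelRun.W F tie 1 I j

    ∑W≤sequential : ∑W ≤ 1-SORT-cost tie 1 I
    ∑W≤sequential = ≤-respʳ (∑-allFin N _)
      (∑-mono jobs λ j → SequentialRun.sequential-completion F tie I j)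

    parallel≤∑W : ∀ m .{{_ : NonZero m}} → fromℕ m * (1-SORT-cost tie m I - Q) ≤ ∑W - Q
    parallel≤∑W m = subst₂ _≤_
      (trans (∑-*ˡ jobs (fromℕ m) _) (cong (fromℕ m *_) (trans (∑-minus _ _)
        (cong (_- Q) (∑-allFin N _)))))
      (∑-minus _ _)
      (∑-mono jobs λ j → ParallelRun.parallel-completion F tie m I j)
      where
      ∑-minus : ∀ f g → ∑ jobs (λ j → f j - g j) ≡ ∑ jobs f - ∑ jobs g
      ∑-minus f g = trans (∑-cong jobs λ j → solve 2 (λ x y → x :- y := x :+ (:- :1) :* y)
          refl (f j) (g j))
        (trans (∑-+ jobs f _) (trans (cong (∑ jobs f +_) (∑-*ˡ jobs (- 1#) g))
          (solve 2 (λ x y → x :+ (:- :1) :* y := x :- y) refl (∑ jobs f) (∑ jobs g))))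

    Q≤∑W : Q ≤ ∑W
    Q≤∑W = ∑-mono jobs λ j → ParallelRun.q≤W F tie 1 I j

  module _ (class : TestTimes) (ρ : Carrier) (competitive : Competitive class 1 (1-SORT-cost tie 1) ρ) where

    private
      -- Test time 1 places it in both classes, and its positive length makes the cost of the
      -- algorithm positive.
      unit : Instance
      unit = record { N = 1 ; t = λ _ → 1# ; p = λ _ → 0# ; 0≤t = λ _ → 0≤1 ; 0≤p = λ _ → ≤-refl }

      unit-inClass : ∀ class → InClass class unit
      unit-inClass arbitrary = _
      unit-inClass uniform   = λ _ → refl

    -- `ρ` is an arbitrary field element, but its sign matters when `opt-bound` is scaled. On `unit`
    -- the algorithm pays at least 1, which a nonpositive multiple of the nonnegative optimum cannot
    -- cover.
    0≤ρ : 0# ≤ ρ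
    0≤ρ with ≤-total 0# ρ
    ... | inj₁ 0≤ρ = 0≤ρ
    ... | inj₂ ρ≤0 = contradiction
      (≤-trans (≤-reflexive (solve 0 (:1 := :1 :+ :0 :+ :0) refl)) (≤-trans (Q≤∑W unit) (≤-trans (∑W≤sequential unit)
        (≤-trans (competitive unit (unit-inClass class) opt₁ opt₁-isOPT)
          (subst₂ _≤_ (*-comm opt₁ ρ) (zeroʳ opt₁)
              (*-monoˡ-≤ (≤-trans (∑-nonNeg jobs 0≤q) Q≤opt₁) ρ≤0))))))
      1≰0
      where open Offline F unit

    module _ (ρ≤2 : ρ ≤ fromℕ 2) (m : ℕ) .{{_ : NonZero m}} (I : Instance) (I∈ : InClass class I)
             (opt : Carrier) (isOPT : IsOPT I m opt) where
      open Offline F I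

      private
        M G : Carrier
        M = fromℕ m
        G = 1-SORT-cost tie m I

        1≤M : 1# ≤ M
        1≤M = positive m
          where
          positive : ∀ m → .{{NonZero m}} → 1# ≤ fromℕ m
          positive (suc m) = ≤-plus (0≤fromℕ m)

        0≤M-1 : 0# ≤ M - 1#
        0≤M-1 = 0≤-difference 1≤M

        M≢0 : M ≢ 0#
        M≢0 eq = 1≰0 (≤-respʳ eq 1≤M)

        alg-bound : M * G ≤ ρ * opt₁ + (M - 1#) * Q
        alg-bound = difference-≤
          (solve 5 (λ m g q w b → (b :+ (m :- :1) :* q) :- m :* g := (b :+ (w :- q)) :- (w :+ m :* (g :- q))) refl
            M G Q (∑W I) (ρ * opt₁))
          (+-mono-≤ (≤-trans (∑W≤sequential I) (competitive I I∈ opt₁ opt₁-isOPT)) (parallel≤∑W I m))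

        opt-bound : opt₁ + opt₁ + (M - 1#) * Q ≤ M * (opt + opt)
        opt-bound = difference-≤
          (solve 4 (λ a m q o → m :* (o :+ o) :- (a :+ a :+ (m :- :1) :* q) := (m :* (o :+ o) :+ q) :- (a :+ a :+ m :* q)) refl
            opt₁ M Q opt)
          (opt₁-parallel isOPT)

        slack : 0# ≤ (M - 1#) * ((fromℕ 2 - ρ) * (opt₁ - Q))
        slack = *-nonNeg 0≤M-1 (*-nonNeg (0≤-difference ρ≤2) (0≤-difference Q≤opt₁))

        X : Carrier
        X = fromℕ 2 * (M + ρ - 1#)

        cleared : (M + 1#) * G ≤ X * opt
        cleared = *-cancelˡ-≤ (≤-trans 0≤1 1≤M) M≢0 (difference-≤
          (solve 6 (λ m g r a q o →
            m :* ((:1 :+ (:1 :+ :0)) :* (m :+ r :- :1) :* o) :- m :* ((m :+ :1) :* g) :=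
            ((m :+ :1) :* (r :* a :+ (m :- :1) :* q) :+ (m :- :1 :+ r) :* (m :* (o :+ o))
              :+ (m :- :1) :* (((:1 :+ (:1 :+ :0)) :- r) :* (a :- q)))
            :- ((m :+ :1) :* (m :* g) :+ (m :- :1 :+ r) :* (a :+ a :+ (m :- :1) :* q) :+ :0)) refl
            M G ρ opt₁ Q opt)
          -- `alg-bound` is scaled by `M + 1#` and `opt-bound` by `M - 1# + ρ`, the denominator and
          -- half the numerator of the ratio. The remaining terms in `opt₁` and `Q` are exactly
          -- `slack`.
          (+-mono-≤ (+-mono-≤
            (*-monoˡ-≤ (0≤+ (≤-trans 0≤1 1≤M) 0≤1) alg-bound)
            (*-monoˡ-≤ (0≤+ 0≤M-1 0≤ρ) opt-bound)) slack))

      parallel-competitive : G ≤ X / (M + 1#) * opt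
      parallel-competitive = *-cancelˡ-≤ (0≤+ (≤-trans 0≤1 1≤M) 0≤1) M+1≢0
        (≤-respʳ (sym (trans
          (solve 4 (λ z x i o → z :* (x :* i :* o) := (z :* i) :* (x :* o))
              refl (M + 1#) X ((M + 1#) ⁻¹) opt)
          (trans (cong (_* (X * opt)) (*-inverseʳ M+1≢0)) (*-identityˡ _)))) cleared)
        where
        M+1≢0 : M + 1# ≢ 0#
        M+1≢0 eq = 1+≢0 (≤-trans 0≤1 1≤M) (trans (+-comm 1# M) eq)

theorem5p1 : ∀ {c ℓ r} (F : OrderedField c ℓ) →
    let open OrderedField F in
    let open Scheduling F in
    (tie : TieRule r) (class : TestTimes) (ρ : Carrier) →
    Competitive class 1 (1-SORT-cost tie 1) ρ →
    ρ ≤ fromℕ 2 →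
    (m : ℕ) → .{{_ : NonZero m}} →
    Competitive class m (1-SORT-cost tie m)
    ((fromℕ 2 * (fromℕ m + ρ - 1#)) / (fromℕ m + 1#))
theorem5p1 F tie class ρ competitive ρ≤2 m = Comparison.parallel-competitive F tie class ρ competitive ρ≤2 m
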